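{- Fix a well-defined algebraic data type (ADT). Let $\phi$ be a flat ADT formula in negation normal form, and let $\tilde\phi$ be its reduct, a formula over uninterpreted functions on the integers and linear integer arithmetic (EUF+LIA). Then $\tilde\phi$ is satisfiable over EUF+LIA if and only if $\phi$ is satisfiable over the ADT.
   Context: **ADTs.** An ADT is given by finitely many sorts $\sigma^d_1,\dots,\sigma^d_k$ and finitely many constructors $f_1,\dots,f_m$, each with a type $f_i:\sigma_1\times\cdots\times\sigma_n\to\sigma_0$ with all $\sigma_j\in\{\sigma^d_1,\dots,\sigma^d_k\}$ ($n=0$ allowed). We write $f_i:\sigma$ if the result sort of $f_i$ is $\sigma$. $\mathbb{T}$ is the set of constructor terms (well-sorted ground terms built only from constructors) and $\mathbb{T}_\sigma$ the set of those of sort $\sigma$. The ADT is well-defined if $\mathbb{T}_\sigma\neq\emptyset$ for every sort $\sigma$. **ADT formulas.** Terms are built from sorted variables, constructors, and selectors $f^j:\sigma_0\to\sigma_j$ (for each constructor $f:\sigma_1\times\cdots\times\sigma_n\to\sigma_0$ and $1\le j\le n$). Atoms are equations $t\approx t'$ between terms of the same sort and testers $\mathit{is}_f(t)$ (for $t$ of the result sort of $f$). Formulas are well-typed Boolean combinations of atoms. A formula is flat if constructors and selectors occur only in equations of the form $g(x_1,\dots,x_n)\approx x_0$ with $x_0,\dots,x_n$ variables (not necessarily distinct), and only in positive positions; so all other atoms are $x\approx y$ or $\mathit{is}_f(x)$ with $x,y$ variables. Negation normal form: built from literals with $\wedge,\vee$. **ADT satisfiability.** Structures $(\mathbb{T},I)$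 have universe $\mathbb{T}$ (sort $\sigma$ ranging over $\mathbb{T}_\sigma$); constructors are interpreted freely (as term formation), $\mathit{is}_f(t)$ holds iff the head symbol of $t$ is $f$, and each selector $f^j$ is interpreted as some total function $I(f^j):\mathbb{T}_{\sigma_0}\to\mathbb{T}_{\sigma_j}$ with $I(f^j)(f(t_1,\dots,t_n))=t_j$ (arbitrary on terms with other head symbols). $\phi$ is satisfiable if it holds for some such structure and some variable assignment. **Reduct.** For $f_i:\sigma$ let $\mathit{Id}_{f_i}=|\{j\in\{1,\dots,i\}\mid f_j:\sigma\}|$. Introduce uninterpreted functions over $\mathbb{Z}$: $\tilde f:\mathbb{Z}^n\to\mathbb{Z}$ for each $n$-ary constructor $f$, $\tilde f^j:\mathbb{Z}\to\mathbb{Z}$ for each selector $f^j$, and $\mathit{ctorId}_\sigma,\mathit{depth}_\sigma:\mathbb{Z}\to\mathbb{Z}$ for each sort $\sigma$. For each variable $x$ of $\phi$ introduce an integer variable $\tilde x$. For each constructor $f:\sigma_1\times\cdots\times\sigma_n\to\sigma_0$ and each sort $\sigma$ define - $\mathit{In}_\sigma(x)$ is $0\le x<|\mathbb{T}_\sigma|$ if $\mathbb{T}_\sigma$ is finite, and $\mathit{true}$ otherwise; - $\mathit{CtorSpec}_f(x_0,\dots,x_n)$ is $\tilde f(x_1,\dots,x_n)\approx x_0\wedge \mathit{ctorId}_{\sigma_0}(x_0)\approx \mathit{Id}_f\wedge\bigwedge_{j=1}^n\big(\tilde f^j(x_0)\approx x_j\wedge \mathit{depth}_{\sigma_0}(x_0)>\mathit{depth}_{\sigma_j}(x_j)\big)$;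 - $\mathit{ExCtorSpec}_f(x)$ is $\exists x_1,\dots,x_n.\ \big(\bigwedge_{j=1}^n\mathit{In}_{\sigma_j}(x_j)\wedge\mathit{CtorSpec}_f(x,x_1,\dots,x_n)\big)$. The formula $\phi^*$ is obtained from $\phi$ by replacing every literal as follows (an empty disjunction is $\mathit{false}$; $\sigma_0$ is the result sort of $f$): 1. $f(x_1,\dots,x_n)\approx x_0$ becomes $\mathit{CtorSpec}_f(\tilde x_0,\dots,\tilde x_n)$; 2. $f^j(x)\approx y$ becomes $\tilde f^j(\tilde x)\approx\tilde y\wedge\bigvee_{g:\sigma_0}\mathit{ExCtorSpec}_g(\tilde x)$, with $g$ ranging over all constructors of result sort $\sigma_0$; 3. $\mathit{is}_f(x)$ becomes $\mathit{ExCtorSpec}_f(\tilde x)$; 4. $\neg\mathit{is}_f(x)$ becomes $\bigvee_{g:\sigma_0,\ g\ne f}\mathit{ExCtorSpec}_g(\tilde x)$; 5. $x\approx y$ becomes $\tilde x\approx\tilde y$; 6. $\neg(x\approx y)$ becomes $\neg(\tilde x\approx\tilde y)$. If $x_1:\sigma_1,\dots,x_l:\sigma_l$ are all variables occurring in $\phi$, the reduct is $\tilde\phi=\phi^*\wedge\bigwedge_{i=1}^l\mathit{In}_{\sigma_i}(\tilde x_i)$. **EUF+LIA satisfiability.** $\tilde\phi$ is satisfiable if it holds over $\mathbb{Z}$ with standard arithmetic, for some interpretation of the uninterpreted functions and some integer assignment of the variables. -}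

module Defs where

open import Data.Empty using (⊥)
open import Data.Fin as Fin using (Fin; zero; suc)
import Data.Fin.Properties as Fin
open import Data.Integer as ℤ using (ℤ; +_)
open import Data.List as List using (List; []; _∷_; _++_; allFin; filter; length)
open import Data.Nat as ℕ using (ℕ; zero; suc; z≤n; s≤s; _⊔_)
import Data.Nat.Properties as ℕ
open import Data.Product using (Σ; ∃; _×_; _,_; proj₁; proj₂)
open import Data.Product.Function.NonDependent.Propositional using (_×-↔_)
open import Data.Sum using (_⊎_; inj₁; inj₂)
open import Data.Sum.Function.Propositional using (_⊎-↔_)
open import Data.Unit using (⊤; tt)
open import Data.Vec as Vec using (Vec; []; _∷_; lookup)
open import Data.Vec.Relation.Unary.All as All using (All; []; _∷_)
open import Data.Vec.Relation.Unary.All.Properties using (lookup⁺)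
open import Function using (_∘_; _↔_; mk↔ₛ′; Inverse)
open import Function.Properties.Inverse using (↔-sym; ↔-trans)
open import Relation.Binary.Construct.Closure.Transitive using (TransClosure; [_]; _∷_)
open import Relation.Binary.PropositionalEquality using (_≡_; refl; sym; subst)
open import Relation.Nullary using (¬_; Dec; yes; no; contradiction)
open import Relation.Nullary.Decidable using (_×-dec_; ¬?)

Finite : Set → Set
Finite A = ∃ λ n → A ↔ Fin n

Finite-↔ : ∀ {A B} → A ↔ B → Finite B → Finite A
Finite-↔ i (n , j) = n , ↔-trans i j

Finite-⊎ : ∀ {A B} → Finite A → Finite B → Finite (A ⊎ B)
Finite-⊎ (m , i) (n , j) = m ℕ.+ n , ↔-trans (i ⊎-↔ j) (↔-sym Fin.+↔⊎)

Finite-× : ∀ {A B} → Finite A → Finite B → Finite (A × B)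
Finite-× (m , i) (n , j) = m ℕ.* n , ↔-trans (i ×-↔ j) (↔-sym Fin.*↔×)

Finite-Σ : ∀ {m} {P : Fin m → Set} → (∀ i → Finite (P i)) → Finite (Σ (Fin m) P)
Finite-Σ {zero} h = 0 , mk↔ₛ′ proj₁ (λ ()) (λ ()) (λ ())
Finite-Σ {suc m} {P} h = Finite-↔ split (Finite-⊎ (h zero) (Finite-Σ (h ∘ suc)))
  where
  split : Σ (Fin (suc m)) P ↔ (P zero ⊎ Σ (Fin m) (P ∘ suc))
  split = mk↔ₛ′
    (λ { (zero , p) → inj₁ p ; (suc i , p) → inj₂ (i , p) })
    (λ { (inj₁ p) → zero , p ; (inj₂ (i , p)) → suc i , p })
    (λ { (inj₁ p) → refl ; (inj₂ (i , p)) → refl })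
    (λ { (zero , p) → refl ; (suc i , p) → refl })

Finite-All : ∀ {A : Set} {P : A → Set} {n} {xs : Vec A n} →
             (∀ j → Finite (P (lookup xs j))) → Finite (All P xs)
Finite-All {xs = []} h =
  1 , mk↔ₛ′ (λ _ → zero) (λ _ → []) (λ { zero → refl }) (λ { [] → refl })
Finite-All {xs = x ∷ xs} h =
  Finite-↔ (mk↔ₛ′ All.uncons (λ { (p , ps) → p ∷ ps }) (λ _ → refl) (λ { (p ∷ ps) → refl }))
           (Finite-× (h zero) (Finite-All (h ∘ suc)))

Fin-bounded : ∀ {n} (h : Fin n → ℕ) → ∃ λ M → ∀ i → h i ℕ.≤ M
Fin-bounded {zero} h = 0 , λ ()
Fin-bounded {suc n} h with Fin-bounded (h ∘ suc)
... | M , ub = h zero ⊔ M , λ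
  { zero    → ℕ.m≤m⊔n (h zero) M
  ; (suc i) → ℕ.≤-trans (ub i) (ℕ.m≤n⊔m (h zero) M)
  }

record ADT : Set where
  field
    #sorts : ℕ
    #ctors : ℕ

  Sort : Set
  Sort = Fin #sorts

  Ctor : Set
  Ctor = Fin #ctors

  field
    arity : Ctor → ℕ
    args  : (f : Ctor) → Vec Sort (arity f)
    res   : Ctor → Sort

module _ (D : ADT) where
  open ADT D

  data 𝕋 : Sort → Set where
    con : (f : Ctor) → All 𝕋 (args f) → 𝕋 (res f)

  WellDefined : Set
  WellDefined = ∀ σ → 𝕋 σ

  head : ∀ {σ} → 𝕋 σ → Ctor
  head (con f _) = f

  -- A variable is a name together with its sort, so there are infinitely many
  -- variables of every sort.
  Name Var : Set
  Name = ℕ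
  Var  = Sort × Name

  data Term : Sort → Set where
    var : ∀ {σ} → Name → Term σ
    con : (f : Ctor) → All Term (args f) → Term (res f)
    sel : (f : Ctor) (j : Fin (arity f)) → Term (res f) → Term (lookup (args f) j)

  infix 6 _≈_
  infixr 5 _∧_
  infixr 4 _∨_

  data Atom : Set where
    _≈_ : ∀ {σ} → Term σ → Term σ → Atom
    is  : (f : Ctor) → Term (res f) → Atom

  data Formula : Set where
    atom    : Atom → Formula
    neg     : Formula → Formula
    _∧_ _∨_ : Formula → Formula → Formula

  data Polarity : Set where
    pos neg : Polarity

  flip : Polarity → Polarity
  flip pos = neg
  flip neg = pos

  -- `FlatAtom p a`: the atom `a` may occur in a position of polarity `p` of a
  -- flat formula.
  data FlatAtom : Polarity → Atom → Set where
    var-eq : ∀ {p σ} (x y : Name) → FlatAtom p (var {σ} x ≈ var y)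
    tester : ∀ {p} (f : Ctor) (x : Name) → FlatAtom p (is f (var x))
    con-eq : (f : Ctor) (xs : All (λ _ → Name) (args f)) (x₀ : Name) →
             FlatAtom pos (con f (All.map var xs) ≈ var x₀)
    sel-eq : (f : Ctor) (j : Fin (arity f)) (x y : Name) →
             FlatAtom pos (sel f j (var x) ≈ var y)

  data FlatAt (p : Polarity) : Formula → Set where
    atom : ∀ {a} → FlatAtom p a → FlatAt p (atom a)
    neg  : ∀ {φ} → FlatAt (flip p) φ → FlatAt p (neg φ)
    _∧_  : ∀ {φ ψ} → FlatAt p φ → FlatAt p ψ → FlatAt p (φ ∧ ψ)
    _∨_  : ∀ {φ ψ} → FlatAt p φ → FlatAt p ψ → FlatAt p (φ ∨ ψ)

  Flat : Formula → Set
  Flat = FlatAt pos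

  data NNF : Formula → Set where
    atom  : (a : Atom) → NNF (atom a)
    ¬atom : (a : Atom) → NNF (neg (atom a))
    _∧_   : ∀ {φ ψ} → NNF φ → NNF ψ → NNF (φ ∧ ψ)
    _∨_   : ∀ {φ ψ} → NNF φ → NNF ψ → NNF (φ ∨ ψ)

  termVars : ∀ {σ} → Term σ → List Var
  argsVars : ∀ {n} {σs : Vec Sort n} → All Term σs → List Var
  termVars {σ} (var x)   = (σ , x) ∷ []
  termVars (con f ts)    = argsVars ts
  termVars (sel f j t)   = termVars t
  argsVars []            = []
  argsVars (t ∷ ts)      = termVars t ++ argsVars ts

  -- All variables occurring in a formula, possibly with repetitions.
  vars : Formula → List Var
  vars (atom (t ≈ u))  = termVars t ++ termVars u
  vars (atom (is f t)) = termVars t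
  vars (neg φ)         = vars φ
  vars (φ ∧ ψ)         = vars φ ++ vars ψ
  vars (φ ∨ ψ)         = vars φ ++ vars ψ

  -- Only the selectors are left open by a structure; they are total, and
  -- arbitrary on terms with a different head symbol.
  record Structure : Set where
    field
      selᴵ     : (f : Ctor) (j : Fin (arity f)) → 𝕋 (res f) → 𝕋 (lookup (args f) j)
      selᴵ-con : (f : Ctor) (j : Fin (arity f)) (ts : All 𝕋 (args f)) →
                 selᴵ f j (con f ts) ≡ lookup⁺ ts j

  Assignment : Set
  Assignment = ∀ {σ} → Name → 𝕋 σ

  module _ (I : Structure) (β : Assignment) where
    open Structure I

    eval  : ∀ {σ} → Term σ → 𝕋 σ
    evals : ∀ {n} {σs : Vec Sort n} → All Term σs → All 𝕋 σs
    eval (var x)     = β x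
    eval (con f ts)  = con f (evals ts)
    eval (sel f j t) = selᴵ f j (eval t)
    evals []         = []
    evals (t ∷ ts)   = eval t ∷ evals ts

    Holds : Formula → Set
    Holds (atom (t ≈ u))  = eval t ≡ eval u
    Holds (atom (is f t)) = head (eval t) ≡ f
    Holds (neg φ)         = ¬ Holds φ
    Holds (φ ∧ ψ)         = Holds φ × Holds ψ
    Holds (φ ∨ ψ)         = Holds φ ⊎ Holds ψ

  Satisfiable : Formula → Set
  Satisfiable φ = Σ Structure λ I → Σ Assignment λ β → Holds I β φ

module _ (D : ADT) where
  open ADT D

  -- A sort is infinite iff arbitrarily long `⟶`-paths start in it, and a path
  -- with as many steps as there are sorts can be pumped.
  _⟶_ : Sort → Sort → Set
  σ ⟶ τ = ∃ λ f → res f ≡ σ × ∃ λ j → lookup (args f) j ≡ τ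

  _⟶?_ : ∀ σ τ → Dec (σ ⟶ τ)
  σ ⟶? τ = Fin.any? λ f → (res f Fin.≟ σ) ×-dec Fin.any? λ j → lookup (args f) j Fin.≟ τ

  Path : ℕ → Sort → Set
  Path zero    σ = ⊤
  Path (suc n) σ = ∃ λ τ → σ ⟶ τ × Path n τ

  path? : ∀ n σ → Dec (Path n σ)
  path? zero    σ = yes tt
  path? (suc n) σ = Fin.any? λ τ → (σ ⟶? τ) ×-dec path? n τ

  truncate : ∀ n {σ} → Path (suc n) σ → Path n σ
  truncate zero    _            = tt
  truncate (suc n) (τ , st , p) = τ , st , truncate n p

  extend : ∀ {n σ τ} → TransClosure _⟶_ σ τ → Path n τ → Path (suc n) σ
  extend [ st ]         p = _ , st , p
  extend {n} (st ∷ sts) p = truncate (suc n) (_ , st , extend sts p)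

  at : ∀ {n σ} → Path n σ → Fin (suc n) → Sort
  at {σ = σ}   _           zero    = σ
  at {suc n}   (_ , _ , p) (suc i) = at p i

  segment : ∀ {n σ} (p : Path n σ) {i j} → i Fin.< j → TransClosure _⟶_ (at p i) (at p j)
  segment {suc n}       (_ , st , p) {zero}  {suc zero}    _         = [ st ]
  segment {suc (suc n)} (_ , st , p) {zero}  {suc (suc j)} _         =
    st ∷ segment p {zero} {suc j} (s≤s z≤n)
  segment {suc n}       (_ , st , p) {suc i} {suc j}       (s≤s i<j) = segment p i<j

  prefix : ∀ {n σ} (p : Path n σ) i → (∀ l → Path l (at p i)) → ∀ l → Path l σ
  prefix         p            zero    h l       = h l
  prefix {suc n} (τ , st , p) (suc i) h zero    = tt
  prefix {suc n} (τ , st , p) (suc i) h (suc l) = τ , st , prefix p i h l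

  cycle : ∀ {σ} → TransClosure _⟶_ σ σ → ∀ l → Path l σ
  cycle c zero    = tt
  cycle c (suc l) = extend c (cycle c l)

  pump : ∀ {σ} → Path #sorts σ → ∀ l → Path l σ
  pump p with Fin.pigeonhole (ℕ.n<1+n #sorts) (at p)
  ... | i , j , i<j , eq =
    prefix p i (cycle (subst (TransClosure _⟶_ (at p i)) (sym eq) (segment p i<j)))

  𝕋-unfold : ∀ σ → 𝕋 D σ ↔ (∃ λ f → res f ≡ σ × All (𝕋 D) (args f))
  𝕋-unfold σ = mk↔ₛ′
    (λ { (con f ts) → f , refl , ts })
    (λ { (f , refl , ts) → con f ts })
    (λ { (f , refl , ts) → refl })
    (λ { (con f ts) → refl })

  ¬Path⇒Finite : ∀ n {σ} → ¬ Path n σ → Finite (𝕋 D σ)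
  ¬Path⇒Finite zero        ¬p = contradiction tt ¬p
  ¬Path⇒Finite (suc n) {σ} ¬p = Finite-↔ (𝕋-unfold σ) (Finite-Σ case)
    where
    case : ∀ f → Finite (res f ≡ σ × All (𝕋 D) (args f))
    case f with res f Fin.≟ σ
    ... | no  r≢σ  = 0 , mk↔ₛ′ (λ (r≡σ , _) → contradiction r≡σ r≢σ) (λ ()) (λ ())
                               (λ (r≡σ , _) → contradiction r≡σ r≢σ)
    ... | yes refl = Finite-↔
      (mk↔ₛ′ proj₂ (refl ,_) (λ _ → refl) (λ { (refl , _) → refl }))
      (Finite-All λ j → ¬Path⇒Finite n λ p → ¬p (_ , (f , refl , j , refl) , p))

  height  : ∀ {σ} → 𝕋 D σ → ℕ
  heights : ∀ {n} {σs : Vec Sort n} → All (𝕋 D) σs → ℕ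
  height (con f ts) = suc (heights ts)
  heights []        = 0
  heights (t ∷ ts)  = height t ⊔ heights ts

  plug : WellDefined D → ∀ {n} (σs : Vec Sort n) j (t : 𝕋 D (lookup σs j)) →
         Σ (All (𝕋 D) σs) λ ts → height t ℕ.≤ heights ts
  plug wd (σ ∷ σs) zero t =
    t ∷ All.universal wd σs , ℕ.m≤m⊔n (height t) _
  plug wd (σ ∷ σs) (suc j) t with plug wd σs j t
  ... | ts , t≤ts = wd σ ∷ ts , ℕ.≤-trans t≤ts (ℕ.m≤n⊔m (height (wd σ)) _)

  Path⇒tall : WellDefined D → ∀ n {σ} → Path n σ → Σ (𝕋 D σ) λ t → n ℕ.≤ height t
  Path⇒tall wd zero {σ} _ = wd σ , z≤n
  Path⇒tall wd (suc n) (_ , (f , refl , j , refl) , p) with Path⇒tall wd n p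
  ... | t , n≤t with plug wd (args f) j t
  ... | ts , t≤ts = con f ts , s≤s (ℕ.≤-trans n≤t t≤ts)

  pumpable⇒¬Finite : WellDefined D → ∀ {σ} → (∀ n → Path n σ) → ¬ Finite (𝕋 D σ)
  pumpable⇒¬Finite wd paths (n , iso) with Fin-bounded (height ∘ Inverse.from iso)
  ... | M , ub with Path⇒tall wd (suc M) (paths (suc M))
  ... | t , M<t = ℕ.<⇒≱ M<t
    (subst (λ u → height u ℕ.≤ M) (Inverse.strictlyInverseʳ iso t) (ub (Inverse.to iso t)))

  finite? : WellDefined D → ∀ σ → Dec (Finite (𝕋 D σ))
  finite? wd σ with path? #sorts σ
  ... | yes p = no (pumpable⇒¬Finite wd (pump p))
  ... | no ¬p = yes (¬Path⇒Finite #sorts ¬p)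

-- Linear integer arithmetic with uninterpreted functions, over free variables
-- `V` and function symbols `F n` of arity `n`. The index of `IntTerm` and `IntFormula`
-- is the number of bound (de Bruijn) variables in scope.
module EUFLIA (V : Set) (F : ℕ → Set) where

  infix 8 _·_
  infixl 7 _⊕_
  infix 6 _≈_ _≤_ _<_ _>_
  infixr 5 _∧_
  infixr 4 _∨_

  data IntTerm (b : ℕ) : Set where
    free  : V → IntTerm b
    bound : Fin b → IntTerm b
    lit   : ℤ → IntTerm b
    _⊕_   : IntTerm b → IntTerm b → IntTerm b
    _·_   : ℤ → IntTerm b → IntTerm b
    app   : ∀ {n} → F n → Vec (IntTerm b) n → IntTerm b

  data IntFormula (b : ℕ) : Set where
    true false  : IntFormula b
    _≈_ _≤_ _<_ : IntTerm b → IntTerm b → IntFormula b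
    neg         : IntFormula b → IntFormula b
    _∧_ _∨_     : IntFormula b → IntFormula b → IntFormula b
    ex          : IntFormula (suc b) → IntFormula b

  _>_ : ∀ {b} → IntTerm b → IntTerm b → IntFormula b
  t > u = u < t

  ⋀ ⋁ : ∀ {b} → List (IntFormula b) → IntFormula b
  ⋀ = List.foldr _∧_ true
  ⋁ = List.foldr _∨_ false

  exs : ∀ n → IntFormula n → IntFormula 0
  exs zero    φ = φ
  exs (suc n) φ = exs n (ex φ)

  Interpretation : Set
  Interpretation = ∀ {n} → F n → Vec ℤ n → ℤ

  module _ (J : Interpretation) (α : V → ℤ) where

    evalℤ  : ∀ {b} → Vec ℤ b → IntTerm b → ℤ
    evalsℤ : ∀ {b n} → Vec ℤ b → Vec (IntTerm b) n → Vec ℤ n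
    evalℤ ρ (free x)   = α x
    evalℤ ρ (bound i)  = lookup ρ i
    evalℤ ρ (lit z)    = z
    evalℤ ρ (t ⊕ u)    = evalℤ ρ t ℤ.+ evalℤ ρ u
    evalℤ ρ (z · t)    = z ℤ.* evalℤ ρ t
    evalℤ ρ (app g ts) = J g (evalsℤ ρ ts)
    evalsℤ ρ []       = []
    evalsℤ ρ (t ∷ ts) = evalℤ ρ t ∷ evalsℤ ρ ts

    Holdsℤ : ∀ {b} → Vec ℤ b → IntFormula b → Set
    Holdsℤ ρ true    = ⊤
    Holdsℤ ρ false   = ⊥
    Holdsℤ ρ (t ≈ u) = evalℤ ρ t ≡ evalℤ ρ u
    Holdsℤ ρ (t ≤ u) = evalℤ ρ t ℤ.≤ evalℤ ρ u
    Holdsℤ ρ (t < u) = evalℤ ρ t ℤ.< evalℤ ρ u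
    Holdsℤ ρ (neg φ) = ¬ Holdsℤ ρ φ
    Holdsℤ ρ (φ ∧ ψ) = Holdsℤ ρ φ × Holdsℤ ρ ψ
    Holdsℤ ρ (φ ∨ ψ) = Holdsℤ ρ φ ⊎ Holdsℤ ρ ψ
    Holdsℤ ρ (ex φ)  = ∃ λ z → Holdsℤ (z ∷ ρ) φ

  Satisfiableℤ : IntFormula 0 → Set
  Satisfiableℤ φ = Σ Interpretation λ J → Σ (V → ℤ) λ α → Holdsℤ J α [] φ

module _ (D : ADT) where
  open ADT D

  data FunSym : ℕ → Set where
    con    : (f : Ctor) → FunSym (arity f)
    sel    : (f : Ctor) → Fin (arity f) → FunSym 1
    ctorId : Sort → FunSym 1
    depth  : Sort → FunSym 1

module Reduct (D : ADT) (wd : WellDefined D) where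
  open ADT D
  open EUFLIA (Var D) (FunSym D)

  -- The constructors are indexed from 0, so `j Fin.≤? i` ranges over
  -- f₁, …, fᵢ and `Id` takes the values 1, 2, … within each sort.
  Id : Ctor → ℕ
  Id i = length (filter (λ j → (j Fin.≤? i) ×-dec (res j Fin.≟ res i)) (allFin #ctors))

  In : ∀ {b} → Sort → IntTerm b → IntFormula b
  In σ x with finite? D wd σ
  ... | yes (n , _) = lit (+ 0) ≤ x ∧ x < lit (+ n)
  ... | no  _       = true

  CtorSpec : ∀ {b} (f : Ctor) → IntTerm b → Vec (IntTerm b) (arity f) → IntFormula b
  CtorSpec f x₀ xs =
    app (con f) xs ≈ x₀ ∧
    app (ctorId (res f)) (x₀ ∷ []) ≈ lit (+ Id f) ∧
    ⋀ (List.map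
        (λ j → app (sel f j) (x₀ ∷ []) ≈ lookup xs j ∧
               app (depth (res f)) (x₀ ∷ []) >
                 app (depth (lookup (args f) j)) (lookup xs j ∷ []))
        (allFin (arity f)))

  -- The argument is a free variable, so it needs no weakening under `exs`.
  ExCtorSpec : Ctor → Var D → IntFormula 0
  ExCtorSpec f x = exs (arity f)
    (⋀ (List.map (λ j → In (lookup (args f) j) (bound j)) (allFin (arity f))) ∧
     CtorSpec f (free x) (Vec.tabulate bound))

  ctorsOf : Sort → List Ctor
  ctorsOf σ = filter (λ g → res g Fin.≟ σ) (allFin #ctors)

  otherCtors : Ctor → List Ctor
  otherCtors f = filter (λ g → ¬? (g Fin.≟ f)) (ctorsOf (res f))

  tilde : Sort → Name D → IntTerm 0
  tilde σ x = free (σ , x)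

  tildes : ∀ {n} {σs : Vec Sort n} → All (λ _ → Name D) σs → Vec (IntTerm 0) n
  tildes = All.reduce (λ {σ} x → tilde σ x)

  posAtom : ∀ {a} → FlatAtom D pos a → IntFormula 0
  posAtom (con-eq f xs x₀) = CtorSpec f (tilde (res f) x₀) (tildes xs)
  posAtom (sel-eq f j x y) =
    app (sel f j) (tilde (res f) x ∷ []) ≈ tilde (lookup (args f) j) y ∧
    ⋁ (List.map (λ g → ExCtorSpec g (res f , x)) (ctorsOf (res f)))
  posAtom (tester f x) = ExCtorSpec f (res f , x)
  posAtom (var-eq {σ = σ} x y) = tilde σ x ≈ tilde σ y

  negAtom : ∀ {a} → FlatAtom D neg a → IntFormula 0
  negAtom (tester f x) =
    ⋁ (List.map (λ g → ExCtorSpec g (res f , x)) (otherCtors f))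
  negAtom (var-eq {σ = σ} x y) = neg (tilde σ x ≈ tilde σ y)

  star : ∀ {φ} → Flat D φ → NNF D φ → IntFormula 0
  star (atom fl)       (atom _)  = posAtom fl
  star (neg (atom fl)) (¬atom _) = negAtom fl
  star (fl ∧ fl′)      (n ∧ n′)  = star fl n ∧ star fl′ n′
  star (fl ∨ fl′)      (n ∨ n′)  = star fl n ∨ star fl′ n′

  reduct : (φ : Formula D) → Flat D φ → NNF D φ → IntFormula 0
  reduct φ fl nnf =
    star fl nnf ∧ ⋀ (List.map (λ (σ , x) → In σ (tilde σ x)) (vars D φ))

{-# OPTIONS --safe #-}
module Submission where

-- From the ADT to the integers, terms of each sort are coded injectively (onto [0, n) for
-- a sort with n terms), and the height serves as the depth.
--
-- Conversely, given a model of the reduct, call a value of a variable determined if its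
-- constructor specification holds; the children of such a value are given by the selectors.
-- A determined value must be decoded to its constructor applied to the decoded children,
-- and this is injective whenever decoding is injective on the children. The values that are
-- not determined are free. In a finite sort, the partial injection on the determined values
-- is extended to all of [0, n) by counting; the finite sorts can be treated one after another
-- as no cycle of sorts goes through them. In an infinite sort, the free values are decoded to
-- terms whose heights differ pairwise by more than the number of determined values, so that
-- no term built by the determined values can coincide with a term of a free one.

open import Defs
open import Axiom.UniquenessOfIdentityProofs.WithK using (uip)
open import Data.Empty using (⊥-elim)
open import Data.Fin as Fin using (Fin; zero; suc; punchOut)
import Data.Fin.Properties as Fin
open import Data.Integer as ℤ using (ℤ; +_; -[1+_]; ∣_∣)
import Data.Integer.Properties as ℤ
open import Data.List as List using (List; []; _∷_; allFin; filter; length)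
import Data.List.Membership.DecPropositional as DecMembership
open import Data.List.Membership.Propositional using (_∈_; find; lose)
import Data.List.Membership.Propositional.Properties as ∈
import Data.List.Properties as List
open import Data.List.Relation.Unary.Any as Any using (Any; here; there)
open import Data.Maybe as Maybe using (Maybe; just; nothing)
import Data.Maybe.Properties as Maybe
open import Data.Nat as ℕ using (ℕ; zero; suc; z≤n; s≤s; _≤_; _<_)
open import Data.Nat.Binary as ℕᵇ using (ℕᵇ; 2[1+_]; 1+[2_])
import Data.Nat.Binary.Properties as ℕᵇ
import Data.Nat.Properties as ℕ
open import Data.Product using (Σ; ∃; _×_; _,_; proj₁; proj₂)
open import Data.Product.Properties using (,-injectiveˡ; ,-injectiveʳ) renaming (≡-dec to ×-≡-dec)
open import Data.Sum using (_⊎_; inj₁; inj₂)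
open import Data.Unit using (⊤; tt)
open import Data.Vec as Vec using (Vec; []; _∷_; lookup)
import Data.Vec.Properties as Vec
open import Data.Vec.Relation.Unary.All as All using (All; []; _∷_)
open import Data.Vec.Relation.Unary.All.Properties using (lookup⁺; lookup⁻)
open import Function using (_∘_; id; Inverse)
open import Function.Bundles using (_⇔_; mk⇔)
open import Relation.Binary.Definitions using (tri<; tri≈; tri>)
open import Relation.Binary.PropositionalEquality hiding (J)
open import Relation.Nullary using (¬_; Dec; yes; no; contradiction)
open import Relation.Nullary.Decidable as Dec using (_×-dec_; ¬?)
open import Relation.Unary using (Decidable)

-- Counting by filters

module _ {A : Set} {P Q : A → Set} (P? : Decidable P) (Q? : Decidable Q)
         (P⊆Q : ∀ {x} → P x → Q x) where

  length-filter-≤ : ∀ xs → length (filter P? xs) ≤ length (filter Q? xs)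
  length-filter-≤ [] = z≤n
  length-filter-≤ (x ∷ xs) with P? x | Q? x
  ... | yes _ | yes _  = s≤s (length-filter-≤ xs)
  ... | yes p | no ¬q  = contradiction (P⊆Q p) ¬q
  ... | no _  | yes _  = ℕ.m≤n⇒m≤1+n (length-filter-≤ xs)
  ... | no _  | no _   = length-filter-≤ xs

  -- `x` itself passes only the second filter. This strictness separates the constructor identifiers
  -- of a sort and makes ranks drop at children.
  length-filter-< : ∀ {x xs} → x ∈ xs → Q x → ¬ P x →
                    length (filter P? xs) < length (filter Q? xs)
  length-filter-< {x} {xs = y ∷ xs} (here refl) q ¬p with P? x | Q? x
  ... | yes p | _      = contradiction p ¬p
  ... | no _  | yes _  = s≤s (length-filter-≤ xs)
  ... | no _  | no ¬q  = contradiction q ¬q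
  length-filter-< {xs = y ∷ xs} (there x∈xs) q ¬p with P? y | Q? y
  ... | yes _ | yes _  = s≤s (length-filter-< x∈xs q ¬p)
  ... | yes p | no ¬q  = contradiction (P⊆Q p) ¬q
  ... | no _  | yes _  = ℕ.m<n⇒m<1+n (length-filter-< x∈xs q ¬p)
  ... | no _  | no _   = length-filter-< x∈xs q ¬p

-- Completing partial injections of a finite set

PartialInjective : {A B : Set} → (A → Maybe B) → Set
PartialInjective p = ∀ {i j b} → p i ≡ just b → p j ≡ just b → i ≡ j

module _ {n : ℕ} where

  -- If every element were hit, choosing preimages would give an injection of `Fin n` into itself
  -- that misses `i`; punching `i` out would embed `n` elements into `n - 1`.
  unused : (p : Fin n → Maybe (Fin n)) → PartialInjective p → ∀ {i} → p i ≡ nothing →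
           ∃ λ b → ∀ j → p j ≢ just b
  unused p inj {i} pi≡∅ with Fin.any? (λ b → Fin.all? λ j → ¬? (Maybe.≡-dec Fin._≟_ (p j) (just b)))
  ... | yes b = b
  ... | no all-used = ⊥-elim (tooMany preimage preimage-injective preimage≢i)
    where
    used : ∀ b → ∃ λ j → p j ≡ just b
    used b with Fin.any? (λ j → Maybe.≡-dec Fin._≟_ (p j) (just b))
    ... | yes j = j
    ... | no ¬j = contradiction (b , λ j e → ¬j (j , e)) all-used
    preimage : Fin n → Fin n
    preimage = proj₁ ∘ used
    preimage-injective : ∀ {a b} → preimage a ≡ preimage b → a ≡ b
    preimage-injective {a} {b} e = Maybe.just-injective
      (trans (sym (proj₂ (used a))) (trans (cong p e) (proj₂ (used b))))
    preimage≢i : ∀ b → i ≢ preimage b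
    preimage≢i b e with () ← trans (sym (trans (cong p e) (proj₂ (used b)))) pi≡∅
    tooMany : ∀ {n} {i : Fin n} (f : Fin n → Fin n) → (∀ {a b} → f a ≡ f b → a ≡ b) →
              ¬ (∀ b → i ≢ f b)
    tooMany {suc n} f f-inj i≢f = ℕ.1+n≰n
      (Fin.injective⇒≤ {f = λ b → punchOut (i≢f b)} (λ {a} {b} → f-inj ∘ Fin.punchOut-injective (i≢f a) (i≢f b)))

  _⊑_ : (p q : Fin n → Maybe (Fin n)) → Set
  p ⊑ q = ∀ {i b} → p i ≡ just b → q i ≡ just b

  extend-at : (p : Fin n → Maybe (Fin n)) → PartialInjective p → ∀ i →
              ∃ λ q → PartialInjective q × p ⊑ q × ∃ λ b → q i ≡ just b
  extend-at p inj i with p i in eq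
  ... | just b = p , inj , (λ e → e) , b , eq
  ... | nothing with unused p inj eq
  ... | t , t∉p = q , q-inj , p⊑q , t , q-i
    where
    q : Fin n → Maybe (Fin n)
    q j with j Fin.≟ i
    ... | yes _ = just t
    ... | no  _ = p j
    q-inj : PartialInjective q
    q-inj {j} {k} ej ek with j Fin.≟ i | k Fin.≟ i
    q-inj {j} {k} ej ek   | yes refl | yes refl = refl
    q-inj {j} {k} refl ek | yes _    | no _     = contradiction ek (t∉p k)
    q-inj {j} {k} ej refl | no _     | yes _    = contradiction ej (t∉p j)
    q-inj {j} {k} ej ek   | no _     | no _     = inj ej ek
    p⊑q : p ⊑ q
    p⊑q {j} e with j Fin.≟ i
    ... | yes refl with () ← trans (sym e) eq
    ... | no _     = e
    q-i : q i ≡ just t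
    q-i with i Fin.≟ i
    ... | yes _  = refl
    ... | no i≢i = contradiction refl i≢i

  extend-on : (js : List (Fin n)) (p : Fin n → Maybe (Fin n)) → PartialInjective p →
              ∃ λ q → PartialInjective q × p ⊑ q × (∀ {i} → i ∈ js → ∃ λ b → q i ≡ just b)
  extend-on [] p inj = p , inj , (λ e → e) , λ ()
  extend-on (i ∷ js) p inj with extend-at p inj i
  ... | q , q-inj , p⊑q , b , qi≡b with extend-on js q q-inj
  ... | r , r-inj , q⊑r , dom = r , r-inj , (λ e → q⊑r (p⊑q e)) , λ
    { (here refl)  → b , q⊑r qi≡b
    ; (there i∈js) → dom i∈js
    }

  extend-total : (p : Fin n → Maybe (Fin n)) → PartialInjective p →
                 ∃ λ (h : Fin n → Fin n) → (∀ {i j} → h i ≡ h j → i ≡ j) ×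
                                           (∀ {i b} → p i ≡ just b → h i ≡ b)
  extend-total p inj with extend-on (allFin n) p inj
  ... | q , q-inj , p⊑q , dom = h
      , (λ {i} {j} e → q-inj (q≡h i) (trans (q≡h j) (cong just (sym e))))
      , λ {i} e → Maybe.just-injective (trans (sym (q≡h i)) (p⊑q e))
    where
    h : Fin n → Fin n
    h i = proj₁ (dom (∈.∈-allFin i))
    q≡h : ∀ i → q i ≡ just (h i)
    q≡h i = proj₂ (dom (∈.∈-allFin i))

lookup⁺-lookup⁻ : ∀ {A : Set} {P : A → Set} {n} {xs : Vec A n} (h : ∀ j → P (lookup xs j)) j →
                  lookup⁺ (lookup⁻ {P = P} {xs = xs} h) j ≡ h j
lookup⁺-lookup⁻ {xs = x ∷ xs} h zero    = refl
lookup⁺-lookup⁻ {P = P} {xs = x ∷ xs} h (suc j) = lookup⁺-lookup⁻ {P = P} {xs = xs} (h ∘ suc) j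

All-ext : ∀ {A : Set} {P : A → Set} {n} {xs : Vec A n} {ps qs : All P xs} →
          (∀ j → lookup⁺ ps j ≡ lookup⁺ qs j) → ps ≡ qs
All-ext {ps = []}     {[]}     _ = refl
All-ext {ps = p ∷ ps} {q ∷ qs} e = cong₂ _∷_ (e zero) (All-ext (e ∘ suc))

-- Coding stacks of numbers in binary

-- A number goes on top of a stack in unary, as a run of `2[1+_]` digits closed by one `1+[2_]`. The
-- code is self-delimiting, so `pop` recovers both parts.
push : ℕ → ℕᵇ → ℕᵇ
push zero    b = 1+[2 b ]
push (suc n) b = 2[1+ push n b ]

pop : ℕᵇ → ℕ × ℕᵇ
pop ℕᵇ.zero  = 0 , ℕᵇ.zero
pop 1+[2 b ] = 0 , b
pop 2[1+ b ] = suc (proj₁ (pop b)) , proj₂ (pop b)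

pop-push : ∀ n b → pop (push n b) ≡ (n , b)
pop-push zero    b = refl
pop-push (suc n) b = cong (λ (m , c) → suc m , c) (pop-push n b)

push-injective : ∀ {m n b c} → push m b ≡ push n c → m ≡ n × b ≡ c
push-injective {m} {n} {b} {c} e = ,-injectiveˡ e′ , ,-injectiveʳ e′
  where
  e′ : (m , b) ≡ (n , c)
  e′ = trans (sym (pop-push m b)) (trans (cong pop e) (pop-push n c))

pushℤ : ℤ → ℕᵇ
pushℤ (+ n)    = push 0 (ℕᵇ.fromℕ n)
pushℤ -[1+ n ] = push 1 (ℕᵇ.fromℕ n)

fromℕ-injective : ∀ {m n} → ℕᵇ.fromℕ m ≡ ℕᵇ.fromℕ n → m ≡ n
fromℕ-injective {m} {n} e = trans (sym (ℕᵇ.toℕ-fromℕ m)) (trans (cong ℕᵇ.toℕ e) (ℕᵇ.toℕ-fromℕ n))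

pushℤ-injective : ∀ {i j} → pushℤ i ≡ pushℤ j → i ≡ j
pushℤ-injective {+ m}    {+ n}    e = cong +_ (fromℕ-injective (proj₂ (push-injective {0} {0} e)))
pushℤ-injective { -[1+ m ]} { -[1+ n ]} e =
  cong -[1+_] (fromℕ-injective (proj₂ (push-injective {1} {1} e)))
pushℤ-injective {+ m}    { -[1+ n ]} ()
pushℤ-injective { -[1+ m ]} {+ n}    ()

-- Enumerating the terms of a sort

module Terms (D : ADT) (wd : WellDefined D) where
  open ADT D

  -- Forgetting the sort index avoids unifying `res f` with `res g` when two terms are compared:
  -- heads and arguments are read off an equation of pairs.
  out : ∀ {σ} → 𝕋 D σ → Σ Ctor λ f → All (𝕋 D) (args f)
  out (con f ts) = f , ts

  res-head : ∀ {σ} (t : 𝕋 D σ) → res (head D t) ≡ σ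
  res-head (con f ts) = refl

  height-lookup⁺ : ∀ {n} {σs : Vec Sort n} (ts : All (𝕋 D) σs) j →
                   height D (lookup⁺ ts j) ≤ heights D ts
  height-lookup⁺ (t ∷ ts) zero    = ℕ.m≤m⊔n _ _
  height-lookup⁺ (t ∷ ts) (suc j) = ℕ.≤-trans (height-lookup⁺ ts j) (ℕ.m≤n⊔m (height D t) _)

  heights-≤ : ∀ {n} {σs : Vec Sort n} (ts : All (𝕋 D) σs) {k} →
              (∀ j → height D (lookup⁺ ts j) ≤ k) → heights D ts ≤ k
  heights-≤ []       h = z≤n
  heights-≤ (t ∷ ts) h = ℕ.⊔-lub (h zero) (heights-≤ ts (h ∘ suc))

  -- Polish notation: constructor numbers in preorder, put on top of the stack `b`. Fixed arities
  -- replace brackets, and the accumulator lets siblings be read off one after another.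
  serialise  : ∀ {σ} → 𝕋 D σ → ℕᵇ → ℕᵇ
  serialises : ∀ {n} {σs : Vec Sort n} → All (𝕋 D) σs → ℕᵇ → ℕᵇ
  serialise (con f ts)  b = push (Fin.toℕ f) (serialises ts b)
  serialises []         b = b
  serialises (t ∷ ts)   b = serialise t (serialises ts b)

  ctorAt? : ∀ σ k → Dec (∃ λ f → Fin.toℕ f ≡ k × res f ≡ σ)
  ctorAt? σ k = Fin.any? λ f → (Fin.toℕ f ℕ.≟ k) ×-dec (res f Fin.≟ σ)

  -- The first argument is fuel bounding the nesting depth; malformed input or exhausted fuel yields
  -- `wd σ`. The popped pair is passed to `parseCtor` so that `pop-push` can rewrite it.
  parse  : ℕ → ∀ σ → ℕᵇ → 𝕋 D σ × ℕᵇ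
  parseCtor : ℕ → ∀ σ → ℕ × ℕᵇ → 𝕋 D σ × ℕᵇ
  parses : ℕ → ∀ {n} (σs : Vec Sort n) → ℕᵇ → All (𝕋 D) σs × ℕᵇ
  parse zero    σ b = wd σ , b
  parse (suc k) σ b = parseCtor k σ (pop b)
  parseCtor k σ (n , b) with ctorAt? σ n
  ... | yes (f , _ , refl) = con f (proj₁ rest) , proj₂ rest
    where
    rest : All (𝕋 D) (args f) × ℕᵇ
    rest = parses k (args f) b
  ... | no _ = wd σ , b
  parses k []       b = [] , b
  parses k (σ ∷ σs) b = proj₁ first ∷ proj₁ rest , proj₂ rest
    where
    first : 𝕋 D σ × ℕᵇ
    first = parse k σ b
    rest : All (𝕋 D) σs × ℕᵇ
    rest = parses k σs (proj₂ first)

  parse-serialise  : ∀ k {σ} (t : 𝕋 D σ) b → height D t ≤ k → parse k σ (serialise t b) ≡ (t , b)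
  parses-serialises : ∀ k {n} {σs : Vec Sort n} (ts : All (𝕋 D) σs) b → heights D ts ≤ k →
                      parses k σs (serialises ts b) ≡ (ts , b)
  parse-serialise (suc k) (con f ts) b (s≤s h)
    rewrite pop-push (Fin.toℕ f) (serialises ts b) with ctorAt? (res f) (Fin.toℕ f)
  ... | no ¬f = contradiction (f , refl , refl) ¬f
  ... | yes (g , e , r) with Fin.toℕ-injective e
  ... | refl with uip r refl
  ... | refl rewrite parses-serialises k ts b h = refl
  parses-serialises k []       b h = refl
  parses-serialises k (t ∷ ts) b h
    rewrite parse-serialise k t (serialises ts b) (ℕ.m⊔n≤o⇒m≤o _ _ h)
          | parses-serialises k ts b (ℕ.m⊔n≤o⇒n≤o (height D t) _ h) = refl

  -- The height is stored first, as the recursion depth for parsing.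
  encode : ∀ {σ} → 𝕋 D σ → ℕ
  encode t = ℕᵇ.toℕ (push (height D t) (serialise t ℕᵇ.zero))

  unpack : ∀ {σ} → ℕ × ℕᵇ → 𝕋 D σ
  unpack (k , b) = proj₁ (parse k _ b)

  unencode : ∀ {σ} → ℕ → 𝕋 D σ
  unencode = unpack ∘ pop ∘ ℕᵇ.fromℕ

  unencode-encode : ∀ {σ} (t : 𝕋 D σ) → unencode (encode t) ≡ t
  unencode-encode t
    rewrite ℕᵇ.fromℕ-toℕ (push (height D t) (serialise t ℕᵇ.zero))
          | pop-push (height D t) (serialise t ℕᵇ.zero)
          | parse-serialise (height D t) t ℕᵇ.zero ℕ.≤-refl = refl

  _≟ᵀ_ : ∀ {σ} (t u : 𝕋 D σ) → Dec (t ≡ u)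
  t ≟ᵀ u with encode t ℕ.≟ encode u
  ... | yes e = yes (trans (sym (unencode-encode t)) (trans (cong unencode e) (unencode-encode u)))
  ... | no ¬e = no λ { refl → ¬e refl }

-- Semantics of the reduct

module Semantics (D : ADT) (wd : WellDefined D) where
  open ADT D
  open Reduct D wd
  open Terms D wd
  module E = EUFLIA (Var D) (FunSym D)

  RangeBy : ∀ {σ} → Dec (Finite (𝕋 D σ)) → ℤ → Set
  RangeBy (yes (n , _)) z = (+ 0 ℤ.≤ z) × (z ℤ.< + n)
  RangeBy (no _)        z = ⊤

  InRange : Sort → ℤ → Set
  InRange σ = RangeBy (finite? D wd σ)

  inRange? : ∀ σ z → Dec (InRange σ z)
  inRange? σ z with finite? D wd σ
  ... | yes (n , _) = (+ 0 ℤ.≤? z) ×-dec (z ℤ.<? + n)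
  ... | no _        = yes tt

  Child : (f : Ctor) → Fin (arity f) → Sort
  Child f = lookup (args f)

  module _ (J : E.Interpretation) where

    Spec : (f : Ctor) → ℤ → Vec ℤ (arity f) → Set
    Spec f v zs =
      J (con f) zs ≡ v ×
      J (ctorId (res f)) (v ∷ []) ≡ + Id f ×
      (∀ j → J (sel f j) (v ∷ []) ≡ lookup zs j ×
             J (depth (Child f j)) (lookup zs j ∷ []) ℤ.< J (depth (res f)) (v ∷ []))

    ExSpec : Ctor → ℤ → Set
    ExSpec f v = ∃ λ zs → (∀ j → InRange (Child f j) (lookup zs j)) × Spec f v zs

  module _ (J : E.Interpretation) (α : Var D → ℤ) where

    infix 4 _⊨_
    _⊨_ : ∀ {b} → Vec ℤ b → E.IntFormula b → Set
    _⊨_ = E.Holdsℤ J α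

    In-⊨ : ∀ {b} (ρ : Vec ℤ b) σ t → (ρ ⊨ In σ t) ≡ InRange σ (E.evalℤ J α ρ t)
    In-⊨ ρ σ t with finite? D wd σ
    ... | yes _ = refl
    ... | no _  = refl

    module _ {A : Set} {b} {ρ : Vec ℤ b} (F : A → E.IntFormula b) where

      ⋀⁺ : ∀ xs → (∀ {x} → x ∈ xs → ρ ⊨ F x) → ρ ⊨ E.⋀ (List.map F xs)
      ⋀⁺ []       h = tt
      ⋀⁺ (x ∷ xs) h = h (here refl) , ⋀⁺ xs (h ∘ there)

      ⋀⁻ : ∀ {xs} → ρ ⊨ E.⋀ (List.map F xs) → ∀ {x} → x ∈ xs → ρ ⊨ F x
      ⋀⁻ (h , hs) (here refl)  = h
      ⋀⁻ (h , hs) (there x∈xs) = ⋀⁻ hs x∈xs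

      ⋁⁺ : ∀ {x xs} → x ∈ xs → ρ ⊨ F x → ρ ⊨ E.⋁ (List.map F xs)
      ⋁⁺ (here refl)  h = inj₁ h
      ⋁⁺ (there x∈xs) h = inj₂ (⋁⁺ x∈xs h)

      ⋁⁻ : ∀ xs → ρ ⊨ E.⋁ (List.map F xs) → ∃ λ x → x ∈ xs × ρ ⊨ F x
      ⋁⁻ (x ∷ xs) (inj₁ h) = x , here refl , h
      ⋁⁻ (x ∷ xs) (inj₂ h) with ⋁⁻ xs h
      ... | y , y∈xs , hy = y , there y∈xs , hy

    exs⁺ : ∀ {n} {φ : E.IntFormula n} zs → zs ⊨ φ → [] ⊨ E.exs n φ
    exs⁺ []       h = h
    exs⁺ (z ∷ zs) h = exs⁺ zs (z , h)

    exs⁻ : ∀ n {φ : E.IntFormula n} → [] ⊨ E.exs n φ → ∃ λ zs → zs ⊨ φ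
    exs⁻ zero    h = [] , h
    exs⁻ (suc n) h with exs⁻ n h
    ... | zs , z , hz = z ∷ zs , hz

    lookup-evals : ∀ {b n} (ρ : Vec ℤ b) (ts : Vec (E.IntTerm b) n) j →
                   E.evalℤ J α ρ (lookup ts j) ≡ lookup (E.evalsℤ J α ρ ts) j
    lookup-evals ρ (t ∷ ts) zero    = refl
    lookup-evals ρ (t ∷ ts) (suc j) = lookup-evals ρ ts j

    evals-bound : ∀ {b n} (ρ : Vec ℤ b) (zs : Vec ℤ n) {is : Fin n → Fin b} →
                  (∀ j → lookup ρ (is j) ≡ lookup zs j) →
                  E.evalsℤ J α ρ (Vec.tabulate (E.bound ∘ is)) ≡ zs
    evals-bound ρ []       h = refl
    evals-bound ρ (z ∷ zs) h = cong₂ _∷_ (h zero) (evals-bound ρ zs (h ∘ suc))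

    module _ {b} (ρ : Vec ℤ b) (f : Ctor) (t : E.IntTerm b) (ts : Vec (E.IntTerm b) (arity f)) where

      CtorSpec⁺ : Spec J f (E.evalℤ J α ρ t) (E.evalsℤ J α ρ ts) → ρ ⊨ CtorSpec f t ts
      CtorSpec⁺ (c , i , s) = c , i , ⋀⁺ _ (allFin (arity f)) λ {j} _ →
        subst (λ z → J (sel f j) (v ∷ []) ≡ z ×
                     J (depth (Child f j)) (z ∷ []) ℤ.< J (depth (res f)) (v ∷ []))
              (sym (lookup-evals ρ ts j)) (s j)
        where
        v : ℤ
        v = E.evalℤ J α ρ t

      CtorSpec⁻ : ρ ⊨ CtorSpec f t ts → Spec J f (E.evalℤ J α ρ t) (E.evalsℤ J α ρ ts)
      CtorSpec⁻ (c , i , s) = c , i , λ j →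
        subst (λ z → J (sel f j) (v ∷ []) ≡ z ×
                     J (depth (Child f j)) (z ∷ []) ℤ.< J (depth (res f)) (v ∷ []))
              (lookup-evals ρ ts j) (⋀⁻ _ s (∈.∈-allFin j))
        where
        v : ℤ
        v = E.evalℤ J α ρ t

    ExCtorSpec⁺ : ∀ f x → ExSpec J f (α x) → [] ⊨ ExCtorSpec f x
    ExCtorSpec⁺ f x (zs , range , spec) = exs⁺ zs
      ( ⋀⁺ _ (allFin (arity f)) (λ {j} _ → subst id (sym (In-⊨ zs (Child f j) (E.bound j))) (range j))
      , CtorSpec⁺ zs f (E.free x) (Vec.tabulate E.bound)
          (subst (Spec J f (α x)) (sym (evals-bound zs zs λ _ → refl)) spec))

    ExCtorSpec⁻ : ∀ f x → [] ⊨ ExCtorSpec f x → ExSpec J f (α x)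
    ExCtorSpec⁻ f x h with exs⁻ (arity f) h
    ... | zs , range , spec =
        zs
      , (λ j → subst id (In-⊨ zs (Child f j) (E.bound j)) (⋀⁻ _ range (∈.∈-allFin j)))
      , subst (Spec J f (α x)) (evals-bound zs zs λ _ → refl)
          (CtorSpec⁻ zs f (E.free x) (Vec.tabulate E.bound) spec)

    lookup-tildes : ∀ {n} {σs : Vec Sort n} (xs : All (λ _ → Name D) σs) j →
                    lookup (E.evalsℤ J α [] (tildes xs)) j ≡ α (lookup σs j , lookup⁺ xs j)
    lookup-tildes (x ∷ xs) zero    = refl
    lookup-tildes (x ∷ xs) (suc j) = lookup-tildes xs j

  lookup-evals-vars : ∀ (I : Structure D) (β : Assignment D) {n} {σs : Vec Sort n}
                      (xs : All (λ _ → Name D) σs) j →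
                      lookup⁺ (evals D I β (All.map var xs)) j ≡ β (lookup⁺ xs j)
  lookup-evals-vars I β (x ∷ xs) zero    = refl
  lookup-evals-vars I β (x ∷ xs) (suc j) = lookup-evals-vars I β xs j

  ∈-ctorsOf : ∀ {g σ} → res g ≡ σ → g ∈ ctorsOf σ
  ∈-ctorsOf {g} e = ∈.∈-filter⁺ _ (∈.∈-allFin g) e

  ctorsOf-res : ∀ {g} σ → g ∈ ctorsOf σ → res g ≡ σ
  ctorsOf-res σ = proj₂ ∘ ∈.∈-filter⁻ (λ g → res g Fin.≟ σ) {xs = allFin #ctors}

  ∈-otherCtors : ∀ {f g} → res g ≡ res f → g ≢ f → g ∈ otherCtors f
  ∈-otherCtors e g≢f = ∈.∈-filter⁺ _ (∈-ctorsOf e) g≢f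

  otherCtors⁻ : ∀ {g} f → g ∈ otherCtors f → res g ≡ res f × g ≢ f
  otherCtors⁻ f g∈ with ∈.∈-filter⁻ (λ g → ¬? (g Fin.≟ f)) {xs = ctorsOf (res f)} g∈
  ... | g∈ctors , g≢f = ctorsOf-res (res f) g∈ctors , g≢f

  -- The list counted for `f` contains the one counted for `i`, and `f` in addition.
  Id-< : ∀ {i f} → res i ≡ res f → i Fin.< f → Id i < Id f
  Id-< {i} {f} e i<f = length-filter-< _ _
    (λ (j≤i , r) → ℕ.≤-trans j≤i (ℕ.<⇒≤ i<f) , trans r e)
    (∈.∈-allFin f) (ℕ.≤-refl , refl) (λ (f≤i , _) → ℕ.<⇒≱ i<f f≤i)

  Id-injective : ∀ {f g} → res f ≡ res g → Id f ≡ Id g → f ≡ g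
  Id-injective {f} {g} r e with Fin.<-cmp f g
  ... | tri≈ _ f≡g _ = f≡g
  ... | tri< f<g _ _ = contradiction e (ℕ.<⇒≢ (Id-< r f<g))
  ... | tri> _ _ g<f = contradiction (sym e) (ℕ.<⇒≢ (Id-< (sym r) g<f))

-- From an ADT model to a model of the reduct

module ADT⇒Reduct (D : ADT) (wd : WellDefined D) (I : Structure D) (β : Assignment D) where
  open ADT D
  open Reduct D wd
  open Terms D wd
  open Semantics D wd
  open Structure I

  codeBy : ∀ {σ} → Dec (Finite (𝕋 D σ)) → 𝕋 D σ → ℤ
  codeBy (yes (n , iso)) t = + Fin.toℕ (Inverse.to iso t)
  codeBy (no _)          t = + encode t

  decodeBy : ∀ {σ} → Dec (Finite (𝕋 D σ)) → ℤ → 𝕋 D σ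
  decodeBy {σ} (yes (n , iso)) z with ∣ z ∣ ℕ.<? n
  ... | yes l = Inverse.from iso (Fin.fromℕ< l)
  ... | no _  = wd σ
  decodeBy (no _) z = unencode ∣ z ∣

  code : ∀ {σ} → 𝕋 D σ → ℤ
  code {σ} = codeBy (finite? D wd σ)

  decode : ∀ {σ} → ℤ → 𝕋 D σ
  decode {σ} = decodeBy (finite? D wd σ)

  decode-code : ∀ {σ} (t : 𝕋 D σ) → decode (code t) ≡ t
  decode-code {σ} t with finite? D wd σ
  ... | no _ = unencode-encode t
  ... | yes (n , iso) with Fin.toℕ (Inverse.to iso t) ℕ.<? n
  ... | yes l = trans (cong (Inverse.from iso) (Fin.fromℕ<-toℕ _ l)) (Inverse.strictlyInverseʳ iso t)
  ... | no ¬l = contradiction (Fin.toℕ<n (Inverse.to iso t)) ¬l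

  code-injective : ∀ {σ} {t u : 𝕋 D σ} → code t ≡ code u → t ≡ u
  code-injective {t = t} {u} e = trans (sym (decode-code t)) (trans (cong decode e) (decode-code u))

  code-InRange : ∀ {σ} (t : 𝕋 D σ) → InRange σ (code t)
  code-InRange {σ} t with finite? D wd σ
  ... | yes (n , iso) = ℤ.+≤+ z≤n , ℤ.+<+ (Fin.toℕ<n (Inverse.to iso t))
  ... | no _          = tt

  J : E.Interpretation
  J (con f)    zs       = code (con f (lookup⁻ λ j → decode (lookup zs j)))
  J (sel f j)  (z ∷ []) = code (selᴵ f j (decode z))
  J (ctorId σ) (z ∷ []) = + Id (head D (decode {σ} z))
  J (depth σ)  (z ∷ []) = + height D (decode {σ} z)

  α : Var D → ℤ
  α (σ , x) = code (β {σ} x)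

  -- `zs` is any vector with the right entries, since a constructor equation supplies the values of
  -- its variables, and `ExSpec-code` a tabulated vector.
  Spec-code : ∀ f (ts : All (𝕋 D) (args f)) zs → (∀ j → lookup zs j ≡ code (lookup⁺ ts j)) →
              Spec J f (code (con f ts)) zs
  Spec-code f ts zs h rewrite decode-code (con f ts) =
      cong (λ us → code (con f us)) (All-ext λ j → trans (lookup⁺-lookup⁻ {P = 𝕋 D} {xs = args f} _ j) (decode-zs j))
    , refl
    , λ j → trans (cong code (selᴵ-con f j ts)) (sym (h j))
          , ℤ.+<+ (s≤s (ℕ.≤-trans (ℕ.≤-reflexive (cong (height D) (decode-zs j)))
                                  (height-lookup⁺ ts j)))
    where
    decode-zs : ∀ j → decode (lookup zs j) ≡ lookup⁺ ts j
    decode-zs j = trans (cong decode (h j)) (decode-code _)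

  ExSpec-code : ∀ f {σ} (t : 𝕋 D σ) → head D t ≡ f → ExSpec J f (code t)
  ExSpec-code f (con f ts) refl = zs , range , Spec-code f ts zs zs-code
    where
    zs : Vec ℤ (arity f)
    zs = Vec.tabulate λ j → code (lookup⁺ ts j)
    zs-code : ∀ j → lookup zs j ≡ code (lookup⁺ ts j)
    zs-code = Vec.lookup∘tabulate _
    range : ∀ j → InRange (Child f j) (lookup zs j)
    range j = subst (InRange (Child f j)) (sym (zs-code j)) (code-InRange (lookup⁺ ts j))

  posAtom⁺ : ∀ {a} (fl : FlatAtom D pos a) → Holds D I β (atom a) → _⊨_ J α [] (posAtom fl)
  posAtom⁺ (var-eq x y) h = cong code h
  posAtom⁺ (tester f x) h = ExCtorSpec⁺ J α f (res f , x) (ExSpec-code f (β x) h)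
  posAtom⁺ (con-eq f xs x₀) h =
    CtorSpec⁺ J α [] f (tilde (res f) x₀) (tildes xs)
      (subst (λ t → Spec J f (code t) zs) h (Spec-code f _ zs λ j →
        trans (lookup-tildes J α xs j) (cong code (sym (lookup-evals-vars I β xs j)))))
    where
    zs : Vec ℤ (arity f)
    zs = E.evalsℤ J α [] (tildes xs)
  posAtom⁺ (sel-eq f j x y) h =
      cong code (trans (cong (selᴵ f j) (decode-code (β x))) h)
    , ⋁⁺ J α _ (∈-ctorsOf (res-head (β x)))
        (ExCtorSpec⁺ J α (head D (β x)) (res f , x) (ExSpec-code _ (β x) refl))

  negAtom⁺ : ∀ {a} (fl : FlatAtom D neg a) → ¬ Holds D I β (atom a) → _⊨_ J α [] (negAtom fl)
  negAtom⁺ (var-eq x y) h e = h (code-injective e)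
  negAtom⁺ (tester f x) h =
    ⋁⁺ J α _ (∈-otherCtors (res-head (β x)) h)
      (ExCtorSpec⁺ J α (head D (β x)) (res f , x) (ExSpec-code _ (β x) refl))

  -- Conjunction and disjunction are monotone, so it suffices to transfer each literal in one
  -- direction.
  star⁺ : ∀ {φ} (fl : Flat D φ) (nnf : NNF D φ) → Holds D I β φ → _⊨_ J α [] (star fl nnf)
  star⁺ (atom fl)       (atom _)  h        = posAtom⁺ fl h
  star⁺ (neg (atom fl)) (¬atom _) h        = negAtom⁺ fl h
  star⁺ (fl ∧ fl′)      (n ∧ n′)  (h , h′) = star⁺ fl n h , star⁺ fl′ n′ h′
  star⁺ (fl ∨ fl′)      (n ∨ n′)  (inj₁ h) = inj₁ (star⁺ fl n h)
  star⁺ (fl ∨ fl′)      (n ∨ n′)  (inj₂ h) = inj₂ (star⁺ fl′ n′ h)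

  reduct⁺ : ∀ φ (fl : Flat D φ) (nnf : NNF D φ) → Holds D I β φ →
            E.Satisfiableℤ (reduct φ fl nnf)
  reduct⁺ φ fl nnf h = J , α , star⁺ fl nnf h , ⋀⁺ J α _ (vars D φ) λ {(σ , x)} _ →
    subst id (sym (In-⊨ J α [] σ (tilde σ x))) (code-InRange (β x))

-- Determined values

module Decode (D : ADT) (wd : WellDefined D) (J : EUFLIA.Interpretation (Var D) (FunSym D))
              (S : List (ADT.Sort D × ℤ))
              (S-range : ∀ {σ v} → (σ , v) ∈ S → Semantics.InRange D wd σ v) where
  open ADT D
  open Reduct D wd using (Id)
  open Terms D wd
  open Semantics D wd
  open DecMembership (×-≡-dec (Fin._≟_ {#sorts}) ℤ._≟_) using (_∈?_)

  child : (f : Ctor) → ℤ → Fin (arity f) → ℤ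
  child f v j = J (sel f j) (v ∷ [])

  depthOf : Sort → ℤ → ℤ
  depthOf σ v = J (depth σ) (v ∷ [])

  -- `ExSpec` without its quantifier: the selector equations leave the values `child f v` as the
  -- only possible witnesses. What remains is decidable.
  record Node (f : Ctor) (v : ℤ) : Set where
    constructor mkNode
    field
      range  : ∀ j → InRange (Child f j) (child f v j)
      con-val : J (con f) (Vec.tabulate (child f v)) ≡ v
      ctor-id  : J (ctorId (res f)) (v ∷ []) ≡ + Id f
      deeper : ∀ j → depthOf (Child f j) (child f v j) ℤ.< depthOf (res f) v
  open Node

  node? : ∀ f v → Dec (Node f v)
  node? f v = Dec.map′ (λ (r , c , i , d) → mkNode r c i d)
                       (λ n → range n , con-val n , ctor-id n , deeper n)
    (Fin.all? (λ j → inRange? (Child f j) (child f v j)) ×-dec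
     (_ ℤ.≟ _) ×-dec (_ ℤ.≟ _) ×-dec
     Fin.all? (λ j → _ ℤ.<? _))

  ExSpec⇒Node : ∀ {f v} → ExSpec J f v → Node f v
  ExSpec⇒Node {f} {v} (zs , r , c , i , s) = mkNode
    (λ j → subst (InRange (Child f j)) (sym (proj₁ (s j))) (r j))
    (trans (cong (J (con f)) zs≡) c)
    i
    (λ j → subst (λ z → depthOf (Child f j) z ℤ.< depthOf (res f) v) (sym (proj₁ (s j))) (proj₂ (s j)))
    where
    zs≡ : Vec.tabulate (child f v) ≡ zs
    zs≡ = trans (Vec.tabulate-cong (proj₁ ∘ s)) (Vec.tabulate∘lookup zs)

  -- Only the values in `S` are forced to be decoded according to `J`. This keeps the
  -- forced values finite in number, although `J` may relate infinitely many integers.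
  Det : Sort → ℤ → Set
  Det σ v = ∃ λ f → res f ≡ σ × (σ , v) ∈ S × Node f v

  det? : ∀ σ v → Dec (Det σ v)
  det? σ v = Fin.any? λ f → (res f Fin.≟ σ) ×-dec ((σ , v) ∈? S) ×-dec node? f v

  Decoding : Set
  Decoding = ∀ σ → ℤ → 𝕋 D σ

  children : Decoding → (f : Ctor) → ℤ → All (𝕋 D) (args f)
  children G f v = lookup⁻ λ j → G (Child f j) (child f v j)

  lookup-children : ∀ G f v j → lookup⁺ (children G f v) j ≡ G (Child f j) (child f v j)
  lookup-children G f v = lookup⁺-lookup⁻ {P = 𝕋 D} {xs = args f} λ j → G (Child f j) (child f v j)

  node : Decoding → ∀ {σ v} → Det σ v → 𝕋 D σ
  node G {v = v} (f , refl , _) = con f (children G f v)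

  out-node : ∀ G {σ v} (d : Det σ v) → out (node G d) ≡ (proj₁ d , children G (proj₁ d) v)
  out-node G (f , refl , _) = refl

  node-cong : ∀ {G G′ : Decoding} {σ v} (d : Det σ v) →
              (∀ j → let f = proj₁ d in G (Child f j) (child f v j) ≡ G′ (Child f j) (child f v j)) →
              node G d ≡ node G′ d
  node-cong {G} {G′} {v = v} (f , refl , _) e = cong (con f) (All-ext λ j →
    trans (lookup-children G f v j) (trans (e j) (sym (lookup-children G′ f v j))))

  -- Both constructors have the identifier that `ctorId` assigns to `v`, and `Id` is injective
  -- within a sort.
  Det-ctor-unique : ∀ {σ v} (d d′ : Det σ v) → proj₁ d ≡ proj₁ d′
  Det-ctor-unique (f , refl , _ , n) (f′ , r′ , _ , n′) = Id-injective (sym r′)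
    (ℤ.+-injective (trans (sym (ctor-id n))
                          (trans (cong (λ τ → J (ctorId τ) (_ ∷ [])) (sym r′)) (ctor-id n′))))

  node-unique : ∀ G {σ v} (d d′ : Det σ v) → node G d ≡ node G d′
  node-unique G d@(f , refl , _) d′@(f′ , r′ , _) with Det-ctor-unique d d′
  ... | refl with uip r′ refl
  ... | refl = refl

  out-args : ∀ {f} {ts us : All (𝕋 D) (args f)} →
             _≡_ {A = Σ Ctor λ g → All (𝕋 D) (args g)} (f , ts) (f , us) → ts ≡ us
  out-args refl = refl

  InjectiveOnRange : Decoding → Sort → Set
  InjectiveOnRange G σ = ∀ {v w} → InRange σ v → InRange σ w → G σ v ≡ G σ w → v ≡ w

  -- Equal terms have the same head and children. Injectivity at the children makes the child values
  -- agree, and `con-val` recovers `v` and `w` from them. It is assumed only at the children of `v`,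
  -- which suits inductions on `v`.
  node-injective : ∀ G {σ v w} (d : Det σ v) (d′ : Det σ w) →
                   (∀ j {z} → let f = proj₁ d in
                     InRange (Child f j) (child f v j) → InRange (Child f j) z →
                     G (Child f j) (child f v j) ≡ G (Child f j) z → child f v j ≡ z) →
                   node G d ≡ node G d′ → v ≡ w
  node-injective G {v = v} {w} d@(f , _ , _ , n) d′@(f′ , _ , _ , n′) inj e
    with trans (sym (out-node G d)) (trans (cong out e) (out-node G d′))
  ... | e′ with cong proj₁ e′
  ... | refl = trans (sym (con-val n)) (trans (cong (J (con f)) (Vec.tabulate-cong same)) (con-val n′))
    where
    same : ∀ j → child f v j ≡ child f w j
    same j = inj j (range n j) (range n′ j)
      (trans (sym (lookup-children G f v j))
        (trans (cong (λ ts → lookup⁺ ts j) (out-args e′)) (lookup-children G f w j)))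

  -- Decoding of the finite sorts

  RangeBy⇒Fin : ∀ {n v} → + 0 ℤ.≤ v → v ℤ.< + n → ∃ λ (i : Fin n) → v ≡ + Fin.toℕ i
  RangeBy⇒Fin {v = + k} _ (ℤ.+<+ k<n) = Fin.fromℕ< k<n , cong +_ (sym (Fin.toℕ-fromℕ< k<n))

  -- A sort with `n` terms has exactly `n` values in range, so along the bijection with `Fin n` the
  -- map `p` becomes a partial injection of `Fin n` into itself, completed by `extend-total`.
  extend-decoding :
    ∀ {σ} (fin : Dec (Finite (𝕋 D σ))) → Finite (𝕋 D σ) →
    (p : ℤ → Maybe (𝕋 D σ)) → PartialInjective p →
    ∃ λ (h : ℤ → 𝕋 D σ) →
      (∀ {v w} → RangeBy fin v → RangeBy fin w → h v ≡ h w → v ≡ w) ×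
      (∀ {v t} → RangeBy fin v → p v ≡ just t → h v ≡ t)
  extend-decoding (no infinite) fin p p-inj = contradiction fin infinite
  extend-decoding {σ} (yes (n , iso)) _ p p-inj = h , h-inj , h-extends
    where
    open Inverse iso
    q : Fin n → Maybe (Fin n)
    q i = Maybe.map to (p (+ Fin.toℕ i))
    q-just : ∀ {i b} → q i ≡ just b → p (+ Fin.toℕ i) ≡ just (from b)
    q-just {i} e with p (+ Fin.toℕ i)
    q-just refl | just t = cong just (sym (strictlyInverseʳ t))
    q-inj : PartialInjective q
    q-inj ei ej = Fin.toℕ-injective (ℤ.+-injective (p-inj (q-just ei) (q-just ej)))
    total : ∃ λ (h : Fin n → Fin n) → (∀ {i j} → h i ≡ h j → i ≡ j) ×
                                      (∀ {i b} → q i ≡ just b → h i ≡ b)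
    total = extend-total q q-inj
    h : ℤ → 𝕋 D σ
    h v with ∣ v ∣ ℕ.<? n
    ... | yes l = from (proj₁ total (Fin.fromℕ< l))
    ... | no _  = wd σ
    h-Fin : ∀ i → h (+ Fin.toℕ i) ≡ from (proj₁ total i)
    h-Fin i with Fin.toℕ i ℕ.<? n
    ... | yes l = cong (from ∘ proj₁ total) (Fin.fromℕ<-toℕ i l)
    ... | no ¬l = contradiction (Fin.toℕ<n i) ¬l
    from-injective : ∀ {a b} → from a ≡ from b → a ≡ b
    from-injective e = trans (sym (strictlyInverseˡ _)) (trans (cong to e) (strictlyInverseˡ _))
    h-inj : ∀ {v w} → (+ 0 ℤ.≤ v) × (v ℤ.< + n) → (+ 0 ℤ.≤ w) × (w ℤ.< + n) → h v ≡ h w → v ≡ w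
    h-inj (0≤v , v<n) (0≤w , w<n) e with RangeBy⇒Fin 0≤v v<n | RangeBy⇒Fin 0≤w w<n
    ... | i , refl | j , refl = cong (+_ ∘ Fin.toℕ) (proj₁ (proj₂ total)
      (from-injective (trans (sym (h-Fin i)) (trans e (h-Fin j)))))
    h-extends : ∀ {v t} → (+ 0 ℤ.≤ v) × (v ℤ.< + n) → p v ≡ just t → h v ≡ t
    h-extends (0≤v , v<n) e with RangeBy⇒Fin 0≤v v<n
    ... | i , refl = trans (h-Fin i)
      (trans (cong from (proj₂ (proj₂ total) (cong (Maybe.map to) e))) (strictlyInverseʳ _))

  -- The sorts without a path of `n` steps are settled at stage `n`. Children of a sort settled at
  -- stage `suc n` have sorts settled at stage `n`, which gives the order of treatment.
  Good : ℕ → Decoding → Set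
  Good n G = ∀ {σ} → ¬ Path D n σ →
             InjectiveOnRange G σ × (∀ {v} (d : Det σ v) → G σ v ≡ node G d)

  ¬Path-child : ∀ {n σ v} → ¬ Path D (suc n) σ → (d : Det σ v) → ∀ j → ¬ Path D n (Child (proj₁ d) j)
  ¬Path-child ¬p (f , r , _) j p = ¬p (_ , (f , r , j , refl) , p)

  module Step (n : ℕ) (G : Decoding) (good : Good n G) where

    forced : ∀ σ → ℤ → Maybe (𝕋 D σ)
    forced σ v with det? σ v
    ... | yes d = just (node G d)
    ... | no _  = nothing

    forced-det : ∀ {σ v} (d : Det σ v) → forced σ v ≡ just (node G d)
    forced-det {σ} {v} d with det? σ v
    ... | yes d′ = cong just (node-unique G d′ d)
    ... | no ¬d  = contradiction d ¬d

    forced-injective : ∀ {σ} → ¬ Path D (suc n) σ → PartialInjective (forced σ)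
    forced-injective {σ} ¬p {v} {w} ev ew with det? σ v | det? σ w
    forced-injective {σ} ¬p {v} {w} refl ew | yes d | yes d′ = node-injective G d d′
      (λ j → proj₁ (good (¬Path-child ¬p d j))) (sym (Maybe.just-injective ew))

    extended : ∀ {σ} (¬p : ¬ Path D (suc n) σ) →
      ∃ λ (h : ℤ → 𝕋 D σ) →
        (∀ {v w} → InRange σ v → InRange σ w → h v ≡ h w → v ≡ w) ×
        (∀ {v t} → InRange σ v → forced σ v ≡ just t → h v ≡ t)
    extended {σ} ¬p = extend-decoding (finite? D wd σ) (¬Path⇒Finite D (suc n) ¬p)
                                      (forced σ) (forced-injective ¬p)

    -- Only newly settled sorts are redefined; leaving the earlier ones alone keeps `node G` and
    -- `node G⁺` equal on all settled sorts.
    G⁺By : ∀ {σ} → Dec (Path D n σ) → Dec (Path D (suc n) σ) → ℤ → 𝕋 D σ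
    G⁺By {σ} (yes _) (no ¬p) = proj₁ (extended ¬p)
    G⁺By {σ} _       _       = G σ

    G⁺ : Decoding
    G⁺ σ = G⁺By (path? D n σ) (path? D (suc n) σ)

    G⁺-old : ∀ {σ} → ¬ Path D n σ → ∀ v → G⁺ σ v ≡ G σ v
    G⁺-old {σ} ¬p v with path? D n σ
    ... | yes p = contradiction p ¬p
    ... | no _  = refl

    node-G⁺ : ∀ {σ v} → ¬ Path D (suc n) σ → (d : Det σ v) → node G d ≡ node G⁺ d
    node-G⁺ ¬p d = node-cong d λ j → sym (G⁺-old (¬Path-child ¬p d j) _)

    G⁺-goodBy : ∀ {σ} (P? : Dec (Path D n σ)) (P⁺? : Dec (Path D (suc n) σ)) → ¬ Path D (suc n) σ →
                (∀ {v w} → InRange σ v → InRange σ w → G⁺By P? P⁺? v ≡ G⁺By P? P⁺? w → v ≡ w) ×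
                (∀ {v} (d : Det σ v) → G⁺By P? P⁺? v ≡ node G⁺ d)
    G⁺-goodBy (no ¬p) _       ¬p⁺ = proj₁ (good ¬p) , λ d → trans (proj₂ (good ¬p) d) (node-G⁺ ¬p⁺ d)
    G⁺-goodBy (yes _) (yes p) ¬p⁺ = contradiction p ¬p⁺
    G⁺-goodBy (yes _) (no ¬p) _   = proj₁ (proj₂ (extended ¬p)) , λ d@(_ , _ , v∈S , _) →
      trans (proj₂ (proj₂ (extended ¬p)) (S-range v∈S) (forced-det d)) (node-G⁺ ¬p d)

    G⁺-good : Good (suc n) G⁺
    G⁺-good {σ} = G⁺-goodBy (path? D n σ) (path? D (suc n) σ)

  good-decoding : ∀ n → ∃ (Good n)
  -- Every sort has a path of no steps, so nothing is claimed at stage 0.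
  good-decoding zero    = (λ σ _ → wd σ) , λ ¬p → contradiction tt ¬p
  good-decoding (suc n) with good-decoding n
  ... | G , good = Step.G⁺ n G good , Step.G⁺-good n G good

  Gᶠ : Decoding
  Gᶠ = proj₁ (good-decoding #sorts)

  Gᶠ-good : Good #sorts Gᶠ
  Gᶠ-good = proj₂ (good-decoding #sorts)

  -- Decoding of the infinite sorts

  N : ℕ
  N = length S

  -- A bounded substitute for `depth`: integer depths may descend forever, but at most `N` entries
  -- of `S` are counted. It is the measure for recursion through determined values.
  rank : Sort → ℤ → ℕ
  rank σ v = length (filter (λ (τ , w) → depthOf τ w ℤ.≤? depthOf σ v) S)

  rank≤N : ∀ σ v → rank σ v ≤ N
  rank≤N σ v = List.length-filter _ S

  -- `v` lies in `S` and is counted for itself, but not for its child of smaller depth, whether or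
  -- not the child lies in `S`.
  rank-child : ∀ {σ v} (d : Det σ v) → ∀ j → rank (Child (proj₁ d) j) (child (proj₁ d) v j) < rank σ v
  rank-child (f , refl , v∈S , n) j = length-filter-< _ _
    (λ le → ℤ.≤-trans le (ℤ.<⇒≤ (deeper n j))) v∈S ℤ.≤-refl (ℤ.<⇒≱ (deeper n j))

  Infinite : Sort → Set
  Infinite = Path D #sorts

  height-bound-at : ∀ σ → ∃ λ B → ¬ Infinite σ → ∀ (t : 𝕋 D σ) → height D t ≤ B
  height-bound-at σ with path? D #sorts σ
  ... | yes p = 0 , λ ¬p → contradiction p ¬p
  ... | no ¬p with ¬Path⇒Finite D #sorts ¬p
  ... | n , iso with Fin-bounded (height D ∘ Inverse.from iso)
  ... | B , ub = B , λ _ t →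
    subst (λ u → height D u ≤ B) (Inverse.strictlyInverseʳ iso t) (ub (Inverse.to iso t))

  height-bound : ∃ λ B → ∀ {σ} → ¬ Infinite σ → ∀ (t : 𝕋 D σ) → height D t ≤ B
  height-bound with Fin-bounded (proj₁ ∘ height-bound-at)
  ... | B , ub = B , λ {σ} ¬p t → ℕ.≤-trans (proj₂ (height-bound-at σ) ¬p t) (ub σ)

  B : ℕ
  B = proj₁ height-bound

  tall : ℕ → ∀ σ → 𝕋 D σ
  tall k σ with path? D #sorts σ
  ... | yes p = proj₁ (Path⇒tall D wd k (pump D p k))
  ... | no _  = wd σ

  tall-height : ∀ k {σ} → Infinite σ → k ≤ height D (tall k σ)
  tall-height k {σ} p with path? D #sorts σ
  ... | yes p′ = proj₂ (Path⇒tall D wd k (pump D p′ k))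
  ... | no ¬p  = contradiction p ¬p

  tall-bound : ∀ k → ∃ λ M → ∀ σ → height D (tall k σ) ≤ M
  tall-bound k = Fin-bounded λ σ → height D (tall k σ)

  -- Targets for the heights of fresh terms. `tall` may overshoot its target, so the next level is
  -- placed above the tallest term it yields in any sort, with more than `N` to spare.
  level : ℕ → ℕ
  -- This exceeds the terms of all finite sorts by more than `N`; the 2 also makes room for a
  -- constant, of height 1, in `height-dichotomy`.
  level zero    = 2 ℕ.+ (B ℕ.+ N)
  level (suc i) = suc (level i ℕ.+ (proj₁ (tall-bound (level i)) ℕ.+ N))

  level-mono : ∀ {i j} → i ≤ j → level i ≤ level j
  level-mono {i} i≤j = go (ℕ.≤⇒≤′ i≤j)
    where
    go : ∀ {j} → i ℕ.≤′ j → level i ≤ level j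
    go ℕ.≤′-refl       = ℕ.≤-refl
    go (ℕ.≤′-step i≤j) = ℕ.m≤n⇒m≤1+n (ℕ.≤-trans (go i≤j) (ℕ.m≤m+n _ _))

  -- All pairs of a sort and a value are numbered at once, so that fresh terms of different sorts
  -- occupy different levels, too.
  index : Sort → ℤ → ℕ
  index σ v = ℕᵇ.toℕ (push (Fin.toℕ σ) (pushℤ v))

  index-injective : ∀ σ τ v w → index σ v ≡ index τ w → (σ , v) ≡ (τ , w)
  index-injective σ τ v w e with push-injective (ℕᵇ.toℕ-injective e)
  ... | eσ , ev = cong₂ _,_ (Fin.toℕ-injective eσ) (pushℤ-injective ev)

  fresh : Decoding
  fresh σ v = tall (level (index σ v)) σ

  -- The gap exceeds the number of constructors that can be put on top of a fresh term.
  fresh-gap : ∀ σ v {j} → index σ v < j → height D (fresh σ v) ℕ.+ N < level j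
  fresh-gap σ v i<j = ℕ.≤-trans
    (s≤s (ℕ.≤-trans (ℕ.+-monoˡ-≤ N (proj₂ (tall-bound _) σ)) (ℕ.m≤n+m _ (level (index σ v)))))
    (level-mono i<j)

  -- Finiteness of the sort takes precedence over being determined, as `Gᶠ` already handles the
  -- determined values there.
  data Kind (σ : Sort) (v : ℤ) : Set where
    finite : ¬ Infinite σ → Kind σ v
    det    : Infinite σ → Det σ v → Kind σ v
    free   : Infinite σ → ¬ Det σ v → Kind σ v

  kind : ∀ σ v → Kind σ v
  kind σ v with path? D #sorts σ | det? σ v
  ... | no ¬p | _     = finite ¬p
  ... | yes p | yes d = det p d
  ... | yes p | no ¬d = free p ¬d

  stepBy : Decoding → ∀ {σ v} → Kind σ v → 𝕋 D σ
  stepBy G {σ} {v} (finite _) = Gᶠ σ v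
  stepBy G         (det _ d)  = node G d
  stepBy G {σ} {v} (free _ _) = fresh σ v

  iterate : ℕ → Decoding
  iterate zero    σ v = wd σ
  iterate (suc k) σ v = stepBy (iterate k) (kind σ v)

  -- A further step recurs only at children of determined values, where the rank is smaller.
  iterate-stable : ∀ k σ v → rank σ v < k → iterate k σ v ≡ iterate (suc k) σ v
  iterate-stable (suc k) σ v (s≤s r) with kind σ v
  ... | finite _ = refl
  ... | free _ _ = refl
  ... | det _ d  = node-cong d λ j → iterate-stable k _ _ (ℕ.≤-trans (rank-child d j) r)

  -- `suc N` iterations reach a fixed point of `stepBy` since every rank is at most `N`.
  abstract
    g : Decoding
    g = iterate (suc N)

    g-unfold : ∀ σ v → g σ v ≡ stepBy g (kind σ v)
    g-unfold σ v = iterate-stable (suc N) σ v (s≤s (rank≤N σ v))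

  g-finite : ∀ {σ v} → ¬ Infinite σ → g σ v ≡ Gᶠ σ v
  g-finite {σ} {v} ¬p with kind σ v | g-unfold σ v
  ... | finite _ | e = e
  ... | det p _  | _ = contradiction p ¬p
  ... | free p _ | _ = contradiction p ¬p

  g-free : ∀ {σ v} → Infinite σ → ¬ Det σ v → g σ v ≡ fresh σ v
  g-free {σ} {v} p ¬d with kind σ v | g-unfold σ v
  ... | finite ¬p | _ = contradiction p ¬p
  ... | det _ d   | _ = contradiction d ¬d
  ... | free _ _  | e = e

  g-det : ∀ {σ v} (d : Det σ v) → g σ v ≡ node g d
  g-det {σ} {v} d with kind σ v | g-unfold σ v
  ... | det _ d′  | e = trans e (node-unique g d′ d)
  ... | free _ ¬d | _ = contradiction d ¬d
  -- `Gᶠ` satisfies the same equation, and the children again have finite sorts, where `g` agrees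
  -- with `Gᶠ`.
  ... | finite ¬p | e = trans e (trans (proj₂ (Gᶠ-good ¬p) d)
    (node-cong d λ j → sym (g-finite (¬Path-child (¬p ∘ truncate D #sorts) d j))))

  level-tower : ∀ i → 2 ℕ.+ (B ℕ.+ N) ≤ level i
  level-tower i = level-mono {zero} {i} z≤n

  -- While a fresh term `u = fresh σ v` is not used, decoded terms stay well below `level`
  -- of its index; a term built from `u` is taller than `u`.
  height-dichotomy : ∀ k {σ v} → Infinite σ → ¬ Det σ v → ∀ τ w → rank τ w < k →
    height D (g τ w) ℕ.+ N < level (index σ v) ℕ.+ rank τ w ⊎
    height D (fresh σ v) < height D (g τ w) ⊎
    (τ , w) ≡ (σ , v)
  height-dichotomy (suc k) {σ} {v} p ¬d τ w (s≤s r)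
    with kind τ w | g-unfold τ w
  ... | finite ¬p | e rewrite e = inj₁ (begin-strict
    height D (Gᶠ τ w) ℕ.+ N        ≤⟨ ℕ.+-monoˡ-≤ N (proj₂ height-bound ¬p _) ⟩
    B ℕ.+ N                        <⟨ ℕ.n<1+n _ ⟩
    1 ℕ.+ (B ℕ.+ N)                ≤⟨ ℕ.n≤1+n _ ⟩
    2 ℕ.+ (B ℕ.+ N)                ≤⟨ level-tower (index σ v) ⟩
    level (index σ v)              ≤⟨ ℕ.m≤m+n _ _ ⟩
    level (index σ v) ℕ.+ rank τ w ∎)
    where open ℕ.≤-Reasoning
  ... | free q _ | e rewrite e with ℕ.<-cmp (index τ w) (index σ v)
  ...   | tri< i<j _ _ = inj₁ (ℕ.≤-trans (fresh-gap τ w i<j) (ℕ.m≤m+n _ _))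
  ...   | tri≈ _ i≡j _ = inj₂ (inj₂ (index-injective τ σ w v i≡j))
  ...   | tri> _ _ j<i = inj₂ (inj₁ (ℕ.≤-trans (s≤s (ℕ.m≤m+n _ N))
                           (ℕ.≤-trans (fresh-gap σ v j<i) (tall-height _ q))))
  height-dichotomy (suc k) {σ} {v} p ¬d τ w (s≤s r) | det _ d@(f , refl , _) | e rewrite e
    with Fin.any? (λ j → height D (fresh σ v) ℕ.≤? height D (g (Child f j) (child f w j)))
  ... | yes (j , u≤) = inj₂ (inj₁ (s≤s (ℕ.≤-trans u≤ (ℕ.≤-trans
    (ℕ.≤-reflexive (cong (height D) (sym (lookup-children g f w j))))
    (height-lookup⁺ (children g f w) j)))))
  -- No child is as tall as `fresh σ v`, so the first alternative holds for all children, and the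
  -- drop in rank at each child pays for the one constructor on top.
  ... | no ¬u≤ = inj₁ (begin
    2 ℕ.+ (heights D (children g f w) ℕ.+ N) ≡⟨ sym (shift (heights D (children g f w))) ⟩
    heights D (children g f w) ℕ.+ (2 ℕ.+ N) ≤⟨ ℕ.+-monoˡ-≤ (2 ℕ.+ N) (heights-≤ (children g f w) child-≤) ⟩
    (bound ℕ.∸ (2 ℕ.+ N)) ℕ.+ (2 ℕ.+ N)      ≡⟨ ℕ.m∸n+n≡m 2+N≤bound ⟩
    bound                                    ∎)
    where
    open ℕ.≤-Reasoning
    bound : ℕ
    bound = level (index σ v) ℕ.+ rank τ w
    shift : ∀ h → h ℕ.+ (2 ℕ.+ N) ≡ 2 ℕ.+ (h ℕ.+ N)
    shift h = trans (ℕ.+-suc h (suc N)) (cong suc (ℕ.+-suc h N))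
    2+N≤bound : 2 ℕ.+ N ≤ bound
    2+N≤bound = ℕ.≤-trans (s≤s (s≤s (ℕ.m≤n+m N B)))
      (ℕ.≤-trans (level-tower (index σ v)) (ℕ.m≤m+n _ _))
    child-bound : ∀ j → height D (g (Child f j) (child f w j)) ℕ.+ (2 ℕ.+ N) ≤ bound
    child-bound j with height-dichotomy k p ¬d (Child f j) (child f w j) (ℕ.≤-trans (rank-child d j) r)
    ... | inj₁ lt = begin
      height D (g (Child f j) (child f w j)) ℕ.+ (2 ℕ.+ N)          ≡⟨ shift _ ⟩
      2 ℕ.+ (height D (g (Child f j) (child f w j)) ℕ.+ N)          ≤⟨ s≤s lt ⟩
      suc (level (index σ v) ℕ.+ rank (Child f j) (child f w j))    ≡⟨ sym (ℕ.+-suc _ _) ⟩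
      level (index σ v) ℕ.+ suc (rank (Child f j) (child f w j))    ≤⟨ ℕ.+-monoʳ-≤ _ (rank-child d j) ⟩
      bound                                                         ∎
    ... | inj₂ (inj₁ lt) = contradiction (j , ℕ.<⇒≤ lt) ¬u≤
    ... | inj₂ (inj₂ eq) = contradiction (j , height-at eq) ¬u≤
      where
      height-at : ∀ {ρ z} → (ρ , z) ≡ (σ , v) → height D (fresh σ v) ≤ height D (g ρ z)
      height-at refl = ℕ.≤-reflexive (cong (height D) (sym (g-free p ¬d)))
    child-≤ : ∀ j → height D (lookup⁺ (children g f w) j) ≤ bound ℕ.∸ (2 ℕ.+ N)
    child-≤ j = subst (λ t → height D t ≤ bound ℕ.∸ (2 ℕ.+ N)) (sym (lookup-children g f w j))
      (ℕ.m+n≤o⇒m≤o∸n _ (child-bound j))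

  -- Of the alternatives of `height-dichotomy` at `w`, the first makes the node lower than
  -- `level (index σ v)`, the second makes it taller than the fresh term, and the third makes `v`
  -- determined.
  node≢fresh : ∀ {σ v w} → Infinite σ → (d : Det σ w) → ¬ Det σ v → node g d ≢ fresh σ v
  node≢fresh {σ} {v} {w} p d ¬d e with height-dichotomy (suc N) p ¬d σ w (s≤s (rank≤N σ w))
  ... | inj₁ lt = ℕ.<⇒≱ (ℕ.≤-trans lt (ℕ.+-monoʳ-≤ _ (rank≤N σ w)))
    (ℕ.+-monoˡ-≤ N (subst (λ t → level (index σ v) ≤ height D t) (sym (trans (g-det d) e)) (tall-height _ p)))
  ... | inj₂ (inj₁ lt)   = ℕ.<⇒≢ lt (cong (height D) (sym (trans (g-det d) e)))
  ... | inj₂ (inj₂ refl) = ¬d d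

  fresh-< : ∀ {σ} v w → Infinite σ → index σ v < index σ w →
            height D (fresh σ v) < height D (fresh σ w)
  fresh-< {σ} v w p i<j = ℕ.≤-trans (s≤s (ℕ.m≤m+n _ N)) (ℕ.≤-trans (fresh-gap σ v i<j) (tall-height _ p))

  fresh-injective : ∀ {σ v w} → Infinite σ → fresh σ v ≡ fresh σ w → v ≡ w
  fresh-injective {σ} {v} {w} p e with ℕ.<-cmp (index σ v) (index σ w)
  ... | tri≈ _ i≡j _ = ,-injectiveʳ (index-injective σ σ v w i≡j)
  ... | tri< i<j _ _ = contradiction (cong (height D) e) (ℕ.<⇒≢ (fresh-< v w p i<j))
  ... | tri> _ _ j<i = contradiction (cong (height D) (sym e)) (ℕ.<⇒≢ (fresh-< w v p j<i))

  -- Induction on the rank of `v` alone: two nodes are compared through the children of `v`, and `w`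
  -- is arbitrary in the hypothesis for them.
  g-injective-below : ∀ k {σ v w} → rank σ v < k → InRange σ v → InRange σ w → g σ v ≡ g σ w → v ≡ w
  g-injective-below (suc k) {σ} {v} {w} (s≤s r) rv rw e
    with kind σ v | kind σ w | trans (sym (g-unfold σ v)) (trans e (g-unfold σ w))
  ... | finite ¬p | finite _  | e′ = proj₁ (Gᶠ-good ¬p) rv rw e′
  ... | finite ¬p | det p _   | _  = contradiction p ¬p
  ... | finite ¬p | free p _  | _  = contradiction p ¬p
  ... | det p _   | finite ¬p | _  = contradiction p ¬p
  ... | free p _  | finite ¬p | _  = contradiction p ¬p
  ... | det p d   | free _ ¬d | e′ = contradiction e′ (node≢fresh p d ¬d)
  ... | free p ¬d | det _ d   | e′ = contradiction (sym e′) (node≢fresh p d ¬d)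
  ... | free p _  | free _ _  | e′ = fresh-injective p e′
  ... | det _ d   | det _ d′  | e′ = node-injective g d d′
    (λ j → g-injective-below k (ℕ.≤-trans (rank-child d j) r)) e′

  g-injective : ∀ {σ} → InjectiveOnRange g σ
  g-injective {σ} {v} = g-injective-below (suc N) (s≤s (rank≤N σ v))

  -- The selectors

  -- On a term with the wrong head symbol, a selector must agree with `J` at the value in
  -- `S` that is decoded to this term; injectivity of `g` makes this value unique.
  Preimage : (f : Ctor) → 𝕋 D (res f) → Sort × ℤ → Set
  Preimage f t (σ , v) = σ ≡ res f × g (res f) v ≡ t

  preimage? : ∀ f t s → Dec (Preimage f t s)
  preimage? f t (σ , v) = (σ Fin.≟ res f) ×-dec (g (res f) v ≟ᵀ t)

  stray : (f : Ctor) (j : Fin (arity f)) → 𝕋 D (res f) → 𝕋 D (Child f j)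
  stray f j t with Any.any? (preimage? f t) S
  ... | yes a = g (Child f j) (child f (proj₂ (proj₁ (find a))) j)
  ... | no _  = wd (Child f j)

  stray-g : ∀ f j {v} → (res f , v) ∈ S → stray f j (g (res f) v) ≡ g (Child f j) (child f v j)
  stray-g f j {v} v∈S with Any.any? (preimage? f (g (res f) v)) S
  ... | no ¬a = contradiction (lose v∈S (refl , refl)) ¬a
  ... | yes a with find a
  ... | (_ , w) , w∈S , refl , e =
    cong (λ z → g (Child f j) (child f z j)) (g-injective (S-range w∈S) (S-range v∈S) e)

  selBy : (f : Ctor) (j : Fin (arity f)) (t : 𝕋 D (res f)) → Dec (proj₁ (out t) ≡ f) → 𝕋 D (Child f j)
  selBy f j t (yes e) = lookup⁺ (subst (All (𝕋 D) ∘ args) e (proj₂ (out t))) j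
  selBy f j t (no _)  = stray f j t

  structure : Structure D
  structure = record
    { selᴵ     = λ f j t → selBy f j t (proj₁ (out t) Fin.≟ f)
    ; selᴵ-con = λ f j ts → selBy-con f j ts (f Fin.≟ f)
    }
    where
    selBy-con : ∀ f j ts (d : Dec (f ≡ f)) → selBy f j (con f ts) d ≡ lookup⁺ ts j
    selBy-con f j ts (yes e) rewrite uip e refl = refl
    selBy-con f j ts (no ¬e) = contradiction refl ¬e

  open Structure structure

  head-g : ∀ {σ v} (d : Det σ v) → head D (g σ v) ≡ proj₁ d
  head-g d@(f , refl , _) = cong (head D) (g-det d)

  -- If the decoded term has head `f`, its arguments are the decoded children by `g-det`; otherwise
  -- `stray` answers. A free value could be decoded to a term with head `f` whose arguments are
  -- unrelated to `J`, hence the premise `Det`, supplied by the disjunction in the reduct of a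
  -- selector equation.
  sel-g : ∀ f j {v} → Det (res f) v → selᴵ f j (g (res f) v) ≡ g (Child f j) (child f v j)
  sel-g f j {v} d@(_ , _ , v∈S , _) = go d (proj₁ (out (g (res f) v)) Fin.≟ f)
    where
    go : Det (res f) v → (e : Dec (proj₁ (out (g (res f) v)) ≡ f)) →
         selBy f j (g (res f) v) e ≡ g (Child f j) (child f v j)
    go _ (no _)  = stray-g f j v∈S
    go d (yes e) with trans (cong proj₁ (sym (trans (cong out (g-det d)) (out-node g d)))) e
    ... | refl rewrite trans (cong out (g-det d)) (out-node g d) | uip e refl = lookup-children g f v j

-- From a model of the reduct to an ADT model

module Reduct⇒ADT (D : ADT) (wd : WellDefined D) (φ : Formula D)
                  (J : EUFLIA.Interpretation (Var D) (FunSym D)) (α : Var D → ℤ)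
                  (in-range : ∀ {x} → x ∈ vars D φ → Semantics.InRange D wd (proj₁ x) (α x)) where
  open ADT D
  open Reduct D wd
  open Semantics D wd

  value : Var D → Sort × ℤ
  value x = proj₁ x , α x

  S : List (Sort × ℤ)
  S = List.map value (vars D φ)

  S-range : ∀ {σ v} → (σ , v) ∈ S → InRange σ v
  S-range s∈S with ∈.∈-map⁻ value s∈S
  ... | x , x∈ , refl = in-range x∈

  open Decode D wd J S S-range
  open Structure structure

  β : Assignment D
  β {σ} x = g σ (α (σ , x))

  _⊆S : List (Var D) → Set
  xs ⊆S = ∀ {x} → x ∈ xs → value x ∈ S

  ExSpec⇒Det : ∀ {f σ v} → res f ≡ σ → (σ , v) ∈ S → ExSpec J f v → Det σ v
  ExSpec⇒Det {f} r v∈S spec = f , r , v∈S , ExSpec⇒Node spec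

  ∈-argsVars : ∀ {n} {σs : Vec Sort n} (xs : All (λ _ → Name D) σs) j →
               (lookup σs j , lookup⁺ xs j) ∈ argsVars D (All.map var xs)
  ∈-argsVars (x ∷ xs) zero    = here refl
  ∈-argsVars (x ∷ xs) (suc j) = there (∈-argsVars xs j)

  posAtom⁻ : ∀ {a} (fl : FlatAtom D pos a) → vars D (atom a) ⊆S → _⊨_ J α [] (posAtom fl) →
             Holds D structure β (atom a)
  posAtom⁻ (var-eq {σ = σ} x y) _ h = cong (g σ) h
  posAtom⁻ (tester f x) ⊆S h =
    head-g (ExSpec⇒Det refl (⊆S (here refl)) (ExCtorSpec⁻ J α f (res f , x) h))
  posAtom⁻ (con-eq f xs x₀) ⊆S h = sym (trans (g-det d) (cong (con f) (All-ext λ j →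
    trans (lookup-children g f _ j) (trans (cong (g (Child f j)) (child≡ j))
      (sym (lookup-evals-vars structure β xs j))))))
    where
    zs : Vec ℤ (arity f)
    zs = E.evalsℤ J α [] (tildes xs)
    spec : Spec J f (α (res f , x₀)) zs
    spec = CtorSpec⁻ J α [] f (tilde (res f) x₀) (tildes xs) h
    zs≡ : ∀ j → lookup zs j ≡ α (Child f j , lookup⁺ xs j)
    zs≡ = lookup-tildes J α xs
    child≡ : ∀ j → child f (α (res f , x₀)) j ≡ α (Child f j , lookup⁺ xs j)
    child≡ j = trans (proj₁ (proj₂ (proj₂ spec) j)) (zs≡ j)
    d : Det (res f) (α (res f , x₀))
    -- The reduct of a constructor equation states no range conditions; they come from the conjuncts
    -- `In` for the variables of `φ`.
    d = ExSpec⇒Det refl (⊆S (∈.∈-++⁺ʳ (argsVars D (All.map var xs)) (here refl)))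
      (zs , (λ j → subst (InRange (Child f j)) (sym (zs≡ j))
                     (S-range (⊆S (∈.∈-++⁺ˡ (∈-argsVars xs j))))) , spec)
  posAtom⁻ (sel-eq f j x y) ⊆S (e , h) with ⋁⁻ J α _ (ctorsOf (res f)) h
  ... | c , c∈ , h′ = trans
    (sel-g f j (ExSpec⇒Det (ctorsOf-res (res f) c∈) (⊆S (here refl))
                           (ExCtorSpec⁻ J α c (res f , x) h′)))
    (cong (g (Child f j)) e)

  negAtom⁻ : ∀ {a} (fl : FlatAtom D neg a) → vars D (atom a) ⊆S → _⊨_ J α [] (negAtom fl) →
             ¬ Holds D structure β (atom a)
  negAtom⁻ (var-eq x y) ⊆S h e =
    h (g-injective (S-range (⊆S (here refl))) (S-range (⊆S (there (here refl)))) e)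
  negAtom⁻ (tester f x) ⊆S h e with ⋁⁻ J α _ (otherCtors f) h
  ... | c , c∈ , h′ with otherCtors⁻ f c∈
  ... | r , c≢f = c≢f (trans (sym (head-g
    (ExSpec⇒Det r (⊆S (here refl)) (ExCtorSpec⁻ J α c (res f , x) h′)))) e)

  star⁻ : ∀ {ψ} (fl : Flat D ψ) (nnf : NNF D ψ) → vars D ψ ⊆S → _⊨_ J α [] (star fl nnf) →
          Holds D structure β ψ
  star⁻ (atom fl)       (atom _)  ⊆S h       = posAtom⁻ fl ⊆S h
  star⁻ (neg (atom fl)) (¬atom _) ⊆S h       = negAtom⁻ fl ⊆S h
  star⁻ {ψ ∧ ψ′} (fl ∧ fl′) (n ∧ n′) ⊆S (h , h′) =
    star⁻ fl n (⊆S ∘ ∈.∈-++⁺ˡ) h , star⁻ fl′ n′ (⊆S ∘ ∈.∈-++⁺ʳ (vars D ψ)) h′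
  star⁻ (fl ∨ fl′) (n ∨ n′) ⊆S (inj₁ h) = inj₁ (star⁻ fl n (⊆S ∘ ∈.∈-++⁺ˡ) h)
  star⁻ {ψ ∨ ψ′} (fl ∨ fl′) (n ∨ n′) ⊆S (inj₂ h) =
    inj₂ (star⁻ fl′ n′ (⊆S ∘ ∈.∈-++⁺ʳ (vars D ψ)) h)

theorem1 : (D : ADT) (wd : WellDefined D) (φ : Formula D) (fl : Flat D φ) (nnf : NNF D φ) →
    EUFLIA.Satisfiableℤ (Var D) (FunSym D) (Reduct.reduct D wd φ fl nnf) ⇔ Satisfiable D φ
theorem1 D wd φ fl nnf = mk⇔ to from
  where
  open Semantics D wd
  to : E.Satisfiableℤ (Reduct.reduct D wd φ fl nnf) → Satisfiable D φ
  to (J , α , h , ranges) = structure , β , star⁻ fl nnf (∈.∈-map⁺ value) h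
    where
    in-range : ∀ {x} → x ∈ vars D φ → InRange (proj₁ x) (α x)
    in-range {σ , x} x∈ = subst id (In-⊨ J α [] σ (Reduct.tilde D wd σ x)) (⋀⁻ J α _ ranges x∈)
    open Reduct⇒ADT D wd φ J α in-range
    open Decode D wd J S S-range
  from : Satisfiable D φ → E.Satisfiableℤ (Reduct.reduct D wd φ fl nnf)
  from (I , β , h) = ADT⇒Reduct.reduct⁺ D wd I β φ fl nnf h
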